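{- Let $q$ be a natural number with $2\le q\le 60$, and let $k$ be an integer with $\gcd(k,q)=1$. Then $k/q$ is the value of a normalized Dedekind sum if and only if $k$ satisfies both of the following conditions: (a) if $3\nmid q$, then $k\equiv 0\pmod 3$; (b) if $2\nmid q$, then $k\equiv 2\pmod 4$ if $q\equiv 3\pmod 4$; $k\equiv 0\pmod 8$ if $q$ is a perfect square; and $k\equiv 0\pmod 4$ otherwise.
   Context: For $x\in\mathbb{R}$ let $((x))=x-\lfloor x\rfloor-1/2$ if $x\notin\mathbb{Z}$ and $((x))=0$ if $x\in\mathbb{Z}$. For $a\in\mathbb{Z}$, $b\in\mathbb{N}$ with $\gcd(a,b)=1$, the classical Dedekind sum is $s(a,b)=\sum_{j=1}^{b}((j/b))((aj/b))$, and the normalized Dedekind sum is $S(a,b)=12\,s(a,b)$. A rational number is "the value of a normalized Dedekind sum" if it equals $S(a,b)$ for some such $a,b$. -}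

module Defs where

open import Data.Nat using (ℕ; zero; suc; NonZero)
open import Data.Integer using (ℤ; +_; _%ℕ_)
import Data.Integer as ℤ
open import Data.Rational using (ℚ; 0ℚ; _+_; _*_; _-_; ½; _/_)
open import Data.List using (List; map; foldr; upTo)

-- sawtooth ((n/b)) for integer n and positive b:
-- 0 if b ∣ n, otherwise frac(n/b) - 1/2 = (n mod b)/b - 1/2
saw : ℤ → (b : ℕ) → .{{NonZero b}} → ℚ
saw n b with n %ℕ b
... | zero  = 0ℚ
... | suc r = (+ suc r / b) - ½

sumℚ : List ℚ → ℚ
sumℚ = foldr _+_ 0ℚ

dedekind : ℤ → (b : ℕ) → .{{NonZero b}} → ℚ
dedekind a b = sumℚ (map (λ j → saw (+ j) b * saw (a ℤ.* + j) b) (map suc (upTo b)))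

normDedekind : ℤ → (b : ℕ) → .{{NonZero b}} → ℚ
normDedekind a b = (+ 12 / 1) * dedekind a b

{-# OPTIONS --safe #-}
-- Let D(a,b) = b·S(a,b), an integer.  Reciprocity reads a D(a,b) + b D(b,a) = a² + b² + 1 - 3ab.
--
-- Necessity.  If S(a,b) = k/q in lowest terms, then b = gq and D(a,b) = gk, and reciprocity gives
-- g ∣ a² + 1, so that D(a,g) = 0.  Subtracting the reciprocity laws for (a,gq) and (a,g),
--   a k = D(g,a) - q D(gq,a) + g (q² - 1) - 3a (q - 1),
-- and the conditions follow from D(·,a) ≡ 0 (mod 3) if 3 ∤ a and, for a odd, from
-- D(·,a) ≡ a - 1 (mod 4) and D(gm²,a) ≡ D(g,a) (mod 8).
--
-- Sufficiency.  If (a b ; c d) is a product of matrices R = (1 1 ; 0 1) and L = (1 0 ; 1 1), c > 0,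
-- then S(a,c) = (a + d)/c - 3 - s, where the weight s is the number of R's minus the number of L's.
-- In a product U B Z with second row (x, qy) of U, first column (qx, y) of Z and B = (f q²e ; e h),
-- the ratio (a + d)/c is K/q with K independent of B: thus varying B only shifts the value by the
-- weight of B.  Taking for B the powers of one such matrix W of weight p, and translating (x, y) by
-- a parabolic element, one reaches k₀ + q (n (q² - 1) - j p) for all n, j ≥ 0, where k₀ may be given
-- any residue prime to q.  It remains to find, for each q ≤ 60, a W for which gcd(p, q² - 1) is as
-- small as the necessary conditions permit.
module Submission where

open import Defs

module DedekindValues where

  open import Data.Nat as ℕ using (ℕ; zero; suc; NonZero; _<_; _≤_; z≤n; s≤s; _%_; _/_)
  import Data.Nat.Properties as ℕ
  open import Data.Nat.DivMod
  open import Data.Nat.Divisibility as ℕ∣ using (_∣_; divides; ∣⇒≤; m%n≡0⇒n∣m; n∣m⇒m%n≡0; _∣?_)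
  open import Data.Nat.Coprimality as Coprime using (Coprime; coprime-Bézout; coprime-divisor; coprime?)
  open import Data.Nat.GCD using (gcd; gcd-GCD; module Bézout)
  open import Data.Nat.Primality using (Prime; prime?; euclidsLemma; prime⇒nonTrivial)
  import Data.Nat.Tactic.RingSolver as ℕ-Solver
  open import Data.Integer as ℤ using (ℤ; +_; -[1+_]; -_; _+_; _*_; _-_; 0ℤ; 1ℤ; ∣_∣; _%ℕ_; _/ℕ_)
  import Data.Integer.Properties as ℤ
  import Data.Integer.DivMod as ℤ
  import Data.Integer.Divisibility.Signed as ℤ∣
  open import Data.Integer.Tactic.RingSolver using (solve-∀)
  open import Data.Rational as ℚ using (ℚ; toℚᵘ)
  import Data.Rational.Properties as ℚ
  open import Data.Rational.Unnormalised as ℚᵘ using (mkℚᵘ; *≡*; _≃_)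
  import Data.Rational.Unnormalised.Properties as ℚᵘ
  open import Data.List using (List; []; _∷_; head; drop; upTo; applyUpTo)
  import Data.List.Properties as List
  open import Data.Maybe using (fromMaybe)
  open import Data.Product using (Σ; ∃-syntax; _×_; _,_; proj₁; proj₂)
  open import Data.Sum using (_⊎_; inj₁; inj₂)
  open import Function using (_∘_)
  open import Relation.Nullary using (¬_; Dec; yes; no; contradiction)
  open import Relation.Nullary.Decidable using (from-yes; _×-dec_; _→-dec_)
  open import Relation.Binary.PropositionalEquality

  -- Finite sums of integers and their rearrangement.

  sum : ℕ → (ℕ → ℤ) → ℤ
  sum zero    f = 0ℤ
  sum (suc n) f = sum n f + f n

  sum-cong : ∀ n {f g} → (∀ i → i < n → f i ≡ g i) → sum n f ≡ sum n g
  sum-cong zero    h = refl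
  sum-cong (suc n) h = cong₂ _+_ (sum-cong n (λ i i<n → h i (ℕ.m<n⇒m<1+n i<n))) (h n ℕ.≤-refl)

  sum-+ : ∀ n f g → sum n (λ i → f i + g i) ≡ sum n f + sum n g
  sum-+ zero    f g = refl
  sum-+ (suc n) f g = trans (cong (_+ (f n + g n)) (sum-+ n f g)) (interchange (sum n f) (sum n g) (f n) (g n))
    where
    interchange : ∀ a b c d → (a + b) + (c + d) ≡ (a + c) + (b + d)
    interchange = solve-∀

  sum-* : ∀ n c f → sum n (λ i → c * f i) ≡ c * sum n f
  sum-* zero    c f = sym (ℤ.*-zeroʳ c)
  sum-* (suc n) c f = trans (cong (_+ c * f n) (sum-* n c f)) (sym (ℤ.*-distribˡ-+ c (sum n f) (f n)))

  sum-zero : ∀ n → sum n (λ _ → 0ℤ) ≡ 0ℤ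
  sum-zero zero    = refl
  sum-zero (suc n) = trans (ℤ.+-identityʳ _) (sum-zero n)

  sum-swap : ∀ m n (f : ℕ → ℕ → ℤ) → sum m (λ i → sum n (f i)) ≡ sum n (λ j → sum m (λ i → f i j))
  sum-swap zero    n f = sym (sum-zero n)
  sum-swap (suc m) n f = trans (cong (_+ sum n (f m)) (sum-swap m n f)) (sym (sum-+ n _ _))

  ind : ∀ {p} {P : Set p} → Dec P → ℤ
  ind (yes _) = 1ℤ
  ind (no _)  = 0ℤ

  ind-yes : ∀ {p} {P : Set p} (d : Dec P) → P → ind d ≡ 1ℤ
  ind-yes (yes _) _ = refl
  ind-yes (no ¬x) x = contradiction x ¬x

  ind-no : ∀ {p} {P : Set p} (d : Dec P) → ¬ P → ind d ≡ 0ℤ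
  ind-no (yes x) ¬x = contradiction x ¬x
  ind-no (no _)  _  = refl

  ind-cong : ∀ {p q} {P : Set p} {Q : Set q} (d : Dec P) (e : Dec Q) → (P → Q) → (Q → P) → ind d ≡ ind e
  ind-cong (yes x) e f g = sym (ind-yes e (f x))
  ind-cong (no ¬x) e f g = sym (ind-no e (¬x ∘ g))

  sum-δ : ∀ n c (φ : ℕ → ℤ) → c < n → sum n (λ j → ind (j ℕ.≟ c) * φ j) ≡ φ c
  sum-δ (suc n) c φ c<1+n with n ℕ.≟ c
  ... | yes refl = trans (cong₂ _+_ (trans (sum-cong n (λ j j<n →
                     cong (_* φ j) (ind-no (j ℕ.≟ n) (ℕ.<⇒≢ j<n)))) (sum-zero n)) (ℤ.*-identityˡ (φ n))) (ℤ.+-identityˡ (φ n))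
  ... | no n≢c   = trans (ℤ.+-identityʳ _) (sum-δ n c φ (ℕ.≤∧≢⇒< (ℕ.≤-pred c<1+n) (n≢c ∘ sym)))

  -- Inserting a Kronecker delta turns the left side into a double sum over i and j; after the
  -- exchange, j = `ρ i` is the only index with i = `π j`.
  sum-permute : ∀ n (π ρ : ℕ → ℕ) (φ : ℕ → ℤ) →
    (∀ j → j < n → π j < n) → (∀ i → i < n → ρ i < n) →
    (∀ j → j < n → ρ (π j) ≡ j) → (∀ i → i < n → π (ρ i) ≡ i) →
    sum n (φ ∘ π) ≡ sum n φ
  sum-permute n π ρ φ π< ρ< ρπ πρ = begin
    sum n (φ ∘ π)
      ≡⟨ sum-cong n (λ j j<n → sym (sum-δ n (π j) φ (π< j j<n))) ⟩
    sum n (λ j → sum n (λ i → ind (i ℕ.≟ π j) * φ i))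
      ≡⟨ sum-swap n n _ ⟩
    sum n (λ i → sum n (λ j → ind (i ℕ.≟ π j) * φ i))
      ≡⟨ sum-cong n (λ i i<n → trans
           (sum-cong n (λ j j<n → cong (_* φ i) (ind-cong (i ℕ.≟ π j) (j ℕ.≟ ρ i)
              (λ e → trans (sym (ρπ j j<n)) (cong ρ (sym e)))
              (λ e → trans (sym (πρ i i<n)) (cong π (sym e))))))
           (sum-δ n (ρ i) (λ _ → φ i) (ρ< i i<n))) ⟩
    sum n φ ∎
    where open ≡-Reasoning

  -- Multiplication by a unit modulo b.

  *-%-assocʳ : ∀ x y b .{{_ : NonZero b}} → (x ℕ.* (y % b)) % b ≡ (x ℕ.* y) % b
  *-%-assocʳ x y b = trans (%-distribˡ-* x (y % b) b)
    (trans (cong (λ z → (x % b ℕ.* z) % b) (m%n%n≡m%n y b)) (sym (%-distribˡ-* x y b)))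

  private
    coprime-inverse : ∀ a b .{{_ : NonZero b}} → Coprime a b → ∃[ a' ] ∀ j → (a' ℕ.* a ℕ.* j) % b ≡ j % b
    coprime-inverse a b@(suc b-1) cop with coprime-Bézout cop
    ... | Bézout.+- x y eq = x , λ j → trans (cong (_% b) (trans (cong (ℕ._* j) (sym eq)) (lem y b j))) ([m+kn]%n≡m%n j (y ℕ.* j) b)
      where
      lem : ∀ y b j → (1 ℕ.+ y ℕ.* b) ℕ.* j ≡ j ℕ.+ y ℕ.* j ℕ.* b
      lem = ℕ-Solver.solve-∀
    -- Here 1 + xa = yb, so -x inverts a modulo b; x (b - 1) is a natural number in that class.
    ... | Bézout.-+ x y eq = x ℕ.* b-1 , λ j → trans (sym ([m+kn]%n≡m%n (x ℕ.* b-1 ℕ.* a ℕ.* j) j b))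
           (trans (cong (_% b) (trans (lem₁ x a b-1 j) (trans (cong (λ z → j ℕ.+ z ℕ.* b-1 ℕ.* j) eq) (lem₂ y b-1 j)))) ([m+kn]%n≡m%n j (y ℕ.* b-1 ℕ.* j) b))
      where
      lem₁ : ∀ x a c j → x ℕ.* c ℕ.* a ℕ.* j ℕ.+ j ℕ.* (1 ℕ.+ c) ≡ j ℕ.+ (1 ℕ.+ x ℕ.* a) ℕ.* c ℕ.* j
      lem₁ = ℕ-Solver.solve-∀
      lem₂ : ∀ y c j → j ℕ.+ y ℕ.* (1 ℕ.+ c) ℕ.* c ℕ.* j ≡ j ℕ.+ y ℕ.* c ℕ.* j ℕ.* (1 ℕ.+ c)
      lem₂ = ℕ-Solver.solve-∀

  sum-permute-* : ∀ a b .{{_ : NonZero b}} (φ : ℕ → ℤ) → Coprime a b →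
    sum b (λ j → φ ((a ℕ.* j) % b)) ≡ sum b φ
  sum-permute-* a b φ cop with coprime-inverse a b cop
  ... | a' , inv = sum-permute b (λ j → (a ℕ.* j) % b) (λ j → (a' ℕ.* j) % b) φ
    (λ j _ → m%n<n (a ℕ.* j) b) (λ j _ → m%n<n (a' ℕ.* j) b)
    (λ j j<b → trans (*-%-assocʳ a' (a ℕ.* j) b) (trans (cong (_% b) (sym (ℕ.*-assoc a' a j))) (trans (inv j) (m<n⇒m%n≡m j<b))))
    (λ j j<b → trans (*-%-assocʳ a (a' ℕ.* j) b) (trans (cong (_% b) (trans (sym (ℕ.*-assoc a a' j)) (cong (ℕ._* j) (ℕ.*-comm a a')))) (trans (inv j) (m<n⇒m%n≡m j<b))))

  2*sum-id : ∀ n → + 2 * sum n (λ j → + j) ≡ + n * (+ n - 1ℤ)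
  2*sum-id zero    = refl
  2*sum-id (suc n) = trans (ℤ.*-distribˡ-+ (+ 2) (sum n (λ j → + j)) (+ n)) (trans (cong (_+ + 2 * + n) (2*sum-id n)) (lem (+ n)))
    where
    lem : ∀ x → x * (x - 1ℤ) + + 2 * x ≡ (1ℤ + x) * ((1ℤ + x) - 1ℤ)
    lem = solve-∀

  6*sum-sq : ∀ n → + 6 * sum n (λ j → + j * + j) ≡ + n * (+ n - 1ℤ) * (+ 2 * + n - 1ℤ)
  6*sum-sq zero    = refl
  6*sum-sq (suc n) = trans (ℤ.*-distribˡ-+ (+ 6) (sum n (λ j → + j * + j)) (+ n * + n)) (trans (cong (_+ + 6 * (+ n * + n)) (6*sum-sq n)) (lem (+ n)))
    where
    lem : ∀ x → x * (x - 1ℤ) * (+ 2 * x - 1ℤ) + + 6 * (x * x) ≡ (1ℤ + x) * ((1ℤ + x) - 1ℤ) * (+ 2 * (1ℤ + x) - 1ℤ)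
    lem = solve-∀

  -- Proof by linear combination of equations.

  infixl 6 _⊕_
  infixl 7 _·_

  _·_ : ∀ c {x y : ℤ} → x ≡ y → c * (x - y) ≡ 0ℤ
  c · x≡y = trans (cong (c *_) (ℤ.i≡j⇒i-j≡0 x≡y)) (ℤ.*-zeroʳ c)

  _⊕_ : ∀ {x y : ℤ} → x ≡ 0ℤ → y ≡ 0ℤ → x + y ≡ 0ℤ
  refl ⊕ refl = refl

  -- Hypotheses enter a polynomial goal through a certificate: the ring solver checks that `x - y`
  -- is a sum of terms c (u - v), and `c · e` with e : u ≡ v makes each of them vanish.
  linear-combination : ∀ {x y d : ℤ} → x - y ≡ d → d ≡ 0ℤ → x ≡ y
  linear-combination e z = ℤ.i-j≡0⇒i≡j _ _ (trans e z)

  -- Lattice points and the reciprocity law.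

  quot : ℕ → (b : ℕ) .{{_ : NonZero b}} → ℕ → ℤ
  quot a b j = + ((a ℕ.* j) / b)

  rem : ℕ → (b : ℕ) .{{_ : NonZero b}} → ℕ → ℤ
  rem a b j = + ((a ℕ.* j) % b)

  rem-quot : ∀ a b .{{_ : NonZero b}} j → rem a b j ≡ + a * + j - + b * quot a b j
  rem-quot a b j = trans (lem (rem a b j) (+ b) (quot a b j)) (cong (_- + b * quot a b j) (begin
    rem a b j + quot a b j * + b           ≡⟨ cong (λ z → rem a b j + z) (sym (ℤ.pos-* ((a ℕ.* j) / b) b)) ⟩
    + ((a ℕ.* j) % b ℕ.+ (a ℕ.* j) / b ℕ.* b) ≡⟨ cong +_ (sym (m≡m%n+[m/n]*n (a ℕ.* j) b)) ⟩
    + (a ℕ.* j)                            ≡⟨ ℤ.pos-* a j ⟩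
    + a * + j                              ∎))
    where
    open ≡-Reasoning
    lem : ∀ r b f → r ≡ r + f * b - b * f
    lem = solve-∀

  quotSum : ℕ → (b : ℕ) .{{_ : NonZero b}} → ℤ
  quotSum a b = sum b (λ j → + j * quot a b j)

  -- D a b is the integer b · S(a, b); see normDedekind-D.
  D : ℕ → (b : ℕ) .{{_ : NonZero b}} → ℤ
  D a b = + 2 * + a * (+ b - 1ℤ) * (+ 2 * + b - 1ℤ) - + 12 * quotSum a b - + 3 * + b * (+ b - 1ℤ)

  sum-triangle : ∀ n m → m < n → + 2 * sum n (λ i → ind (i ℕ.≤? m) * + i) ≡ + m * (+ m + 1ℤ)
  sum-triangle (suc n) m m<1+n with ℕ.m≤n⇒m<n∨m≡n (ℕ.≤-pred m<1+n)
  ... | inj₁ m<n = trans (cong (λ z → + 2 * (sum n (λ i → ind (i ℕ.≤? m) * + i) + z * + n)) (ind-no (n ℕ.≤? m) (ℕ.<⇒≱ m<n)))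
                     (trans (cong (+ 2 *_) (ℤ.+-identityʳ _)) (sum-triangle n m m<n))
  ... | inj₂ refl = trans (cong (+ 2 *_) (sum-cong (suc m) (λ i i<1+m →
                       trans (cong (_* + i) (ind-yes (i ℕ.≤? m) (ℕ.≤-pred i<1+m))) (ℤ.*-identityˡ (+ i)))))
                      (trans (2*sum-id (suc m)) (lem (+ m)))
    where
    lem : ∀ x → (1ℤ + x) * ((1ℤ + x) - 1ℤ) ≡ x * (x + 1ℤ)
    lem = solve-∀

  sum-count : ∀ n g → g < n → sum n (λ j → ind (g ℕ.<? j)) ≡ + n - 1ℤ - + g
  sum-count (suc n) g g<1+n with ℕ.m≤n⇒m<n∨m≡n (ℕ.≤-pred g<1+n)
  ... | inj₁ g<n = trans (cong₂ _+_ (sum-count n g g<n) (ind-yes (g ℕ.<? n) g<n)) (lem (+ n) (+ g))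
    where
    lem : ∀ x y → x - 1ℤ - y + 1ℤ ≡ 1ℤ + x - 1ℤ - y
    lem = solve-∀
  ... | inj₂ refl = trans (sum-cong (suc g) (λ j j<1+g → ind-no (g ℕ.<? j) (ℕ.≤⇒≯ (ℕ.≤-pred j<1+g))))
                      (trans (sum-zero (suc g)) (lem (+ g)))
    where
    lem : ∀ x → 0ℤ ≡ 1ℤ + x - 1ℤ - x
    lem = solve-∀

  quot< : ∀ a b .{{_ : NonZero a}} .{{_ : NonZero b}} j → j < b → (a ℕ.* j) / b < a
  quot< a b j j<b = m<n*o⇒m/o<n (ℕ.*-monoʳ-< a j<b)

  -- Coprimality keeps the interior lattice points of the rectangle off its diagonal.
  below⇒above : ∀ a b .{{_ : NonZero a}} .{{_ : NonZero b}} → Coprime a b → ∀ i j → 0 < i → i < a →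
    i ≤ (a ℕ.* j) / b → (b ℕ.* i) / a < j
  below⇒above a b cop i j 0<i i<a i≤ = m<n*o⇒m/o<n (ℕ.≤∧≢⇒<
    (subst₂ _≤_ (ℕ.*-comm i b) (ℕ.*-comm a j) (ℕ.≤-trans (ℕ.*-monoˡ-≤ b i≤) (m/n*n≤m (a ℕ.* j) b)))
    (λ e → ℕ.<⇒≱ i<a (∣⇒≤ {{ℕ.>-nonZero 0<i}} (coprime-divisor cop (divides j e)))))

  above⇒below : ∀ a b .{{_ : NonZero a}} .{{_ : NonZero b}} → ∀ i j →
    (b ℕ.* i) / a < j → i ≤ (a ℕ.* j) / b
  above⇒below a b i j g<j = subst (_≤ (a ℕ.* j) / b) (m*n/n≡m i b) (/-monoˡ-≤ b (begin
    i ℕ.* b ≡⟨ ℕ.*-comm i b ⟩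
    b ℕ.* i ≡⟨ m≡m%n+[m/n]*n (b ℕ.* i) a ⟩
    (b ℕ.* i) % a ℕ.+ (b ℕ.* i) / a ℕ.* a ≤⟨ ℕ.+-monoˡ-≤ _ (ℕ.<⇒≤ (m%n<n (b ℕ.* i) a)) ⟩
    suc ((b ℕ.* i) / a) ℕ.* a ≤⟨ ℕ.*-monoˡ-≤ a g<j ⟩
    j ℕ.* a ≡⟨ ℕ.*-comm j a ⟩
    a ℕ.* j ∎))
    where open ℕ.≤-Reasoning

  -- Both sides give the weight 2i to each lattice point (i, j) with 1 ≤ i ≤ aj/b and j < b. Summing
  -- over i first yields the left side; for fixed i the points are those with j > bi/a, which yields
  -- the right side.
  lattice-count : ∀ a b .{{_ : NonZero a}} .{{_ : NonZero b}} → Coprime a b →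
    sum b (λ j → quot a b j * (quot a b j + 1ℤ)) ≡ (+ b - 1ℤ) * (+ a * (+ a - 1ℤ)) - + 2 * quotSum b a
  lattice-count a b cop = begin
    sum b (λ j → quot a b j * (quot a b j + 1ℤ))
      ≡⟨ sum-cong b (λ j j<b → sym (sum-triangle a ((a ℕ.* j) / b) (quot< a b j j<b))) ⟩
    sum b (λ j → + 2 * sum a (λ i → ind (i ℕ.≤? (a ℕ.* j) / b) * + i))
      ≡⟨ sum-* b (+ 2) _ ⟩
    + 2 * sum b (λ j → sum a (λ i → ind (i ℕ.≤? (a ℕ.* j) / b) * + i))
      ≡⟨ cong (+ 2 *_) (sum-swap b a _) ⟩
    + 2 * sum a (λ i → sum b (λ j → ind (i ℕ.≤? (a ℕ.* j) / b) * + i))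
      ≡⟨ cong (+ 2 *_) (sum-cong a column) ⟩
    + 2 * sum a (λ i → (+ b - 1ℤ) * + i + - 1ℤ * (+ i * quot b a i))
      ≡⟨ cong (+ 2 *_) (trans (sum-+ a _ _) (cong₂ _+_ (sum-* a (+ b - 1ℤ) (λ i → + i)) (sum-* a (- 1ℤ) _))) ⟩
    + 2 * ((+ b - 1ℤ) * sum a (λ i → + i) + - 1ℤ * quotSum b a)
      ≡⟨ lem₂ (+ b) (sum a (λ i → + i)) (quotSum b a) ⟩
    (+ b - 1ℤ) * (+ 2 * sum a (λ i → + i)) - + 2 * quotSum b a
      ≡⟨ cong (λ z → (+ b - 1ℤ) * z - + 2 * quotSum b a) (2*sum-id a) ⟩
    (+ b - 1ℤ) * (+ a * (+ a - 1ℤ)) - + 2 * quotSum b a ∎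
    where
    open ≡-Reasoning
    lem₁ : ∀ b i g → i * (b - 1ℤ - g) ≡ (b - 1ℤ) * i + - 1ℤ * (i * g)
    lem₁ = solve-∀
    lem₂ : ∀ b s f → + 2 * ((b - 1ℤ) * s + - 1ℤ * f) ≡ (b - 1ℤ) * (+ 2 * s) - + 2 * f
    lem₂ = solve-∀
    count : ∀ i → i < a → 0 < i → sum b (λ j → ind (i ℕ.≤? (a ℕ.* j) / b)) ≡ + b - 1ℤ - quot b a i
    count i i<a 0<i = trans
      (sum-cong b (λ j _ → ind-cong (i ℕ.≤? (a ℕ.* j) / b) ((b ℕ.* i) / a ℕ.<? j)
         (below⇒above a b cop i j 0<i i<a) (above⇒below a b i j)))
      (sum-count b ((b ℕ.* i) / a) (quot< b a i i<a))
    column : ∀ i → i < a → sum b (λ j → ind (i ℕ.≤? (a ℕ.* j) / b) * + i) ≡ (+ b - 1ℤ) * + i + - 1ℤ * (+ i * quot b a i)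
    -- The points with i = 0 have weight 0. `count` would be off by one for them, since (0, 0) lies
    -- on the diagonal.
    column zero    i<a = trans (trans (sum-cong b (λ j _ → ℤ.*-zeroʳ (ind (0 ℕ.≤? (a ℕ.* j) / b)))) (sum-zero b))
                           (sym (trans (cong (_+ 0ℤ) (ℤ.*-zeroʳ (+ b - 1ℤ))) refl))
    column i@(suc _) i<a = begin
      sum b (λ j → ind (i ℕ.≤? (a ℕ.* j) / b) * + i)   ≡⟨ sum-cong b (λ j _ → ℤ.*-comm (ind (i ℕ.≤? (a ℕ.* j) / b)) (+ i)) ⟩
      sum b (λ j → + i * ind (i ℕ.≤? (a ℕ.* j) / b))   ≡⟨ sum-* b (+ i) _ ⟩
      + i * sum b (λ j → ind (i ℕ.≤? (a ℕ.* j) / b))   ≡⟨ cong (+ i *_) (count i i<a (s≤s z≤n)) ⟩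
      + i * (+ b - 1ℤ - quot b a i)                    ≡⟨ lem₁ (+ b) (+ i) (quot b a i) ⟩
      (+ b - 1ℤ) * + i + - 1ℤ * (+ i * quot b a i)     ∎

  -- The remainders aj - b⌊aj/b⌋ are 0, ..., b - 1 in another order. Here their first moments are
  -- compared, in `sum-rem²` the second moments.
  sum-rem : ∀ a b .{{_ : NonZero b}} → Coprime a b →
    + a * sum b (λ j → + j) - + b * sum b (quot a b) ≡ sum b (λ j → + j)
  sum-rem a b cop = begin
    + a * sum b (λ j → + j) - + b * sum b (quot a b)
      ≡⟨ lem (+ a) (sum b (λ j → + j)) (+ b) (sum b (quot a b)) ⟩
    + a * sum b (λ j → + j) + (- + b) * sum b (quot a b)
      ≡⟨ sym (trans (sum-+ b _ _) (cong₂ _+_ (sum-* b (+ a) _) (sum-* b (- + b) _))) ⟩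
    sum b (λ j → + a * + j + (- + b) * quot a b j)
      ≡⟨ sum-cong b (λ j _ → trans (sym (lem (+ a) (+ j) (+ b) (quot a b j))) (sym (rem-quot a b j))) ⟩
    sum b (rem a b)
      ≡⟨ sum-permute-* a b +_ cop ⟩
    sum b (λ j → + j) ∎
    where
    open ≡-Reasoning
    lem : ∀ a x b y → a * x - b * y ≡ a * x + (- b) * y
    lem = solve-∀

  sum-rem² : ∀ a b .{{_ : NonZero b}} → Coprime a b →
    + a * + a * sum b (λ j → + j * + j) - + 2 * + a * + b * quotSum a b + + b * + b * sum b (λ j → quot a b j * quot a b j)
      ≡ sum b (λ j → + j * + j)
  sum-rem² a b cop = begin
    + a * + a * sum b (λ j → + j * + j) - + 2 * + a * + b * quotSum a b + + b * + b * sum b (λ j → quot a b j * quot a b j)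
      ≡⟨ lem₁ (+ a) (sum b (λ j → + j * + j)) (+ b) (quotSum a b) (sum b (λ j → quot a b j * quot a b j)) ⟩
    (+ a * + a * sum b (λ j → + j * + j) + (- (+ 2 * + a * + b)) * quotSum a b) + + b * + b * sum b (λ j → quot a b j * quot a b j)
      ≡⟨ sym (trans (sum-+ b _ _) (cong₂ _+_ (trans (sum-+ b _ _)
           (cong₂ _+_ (sum-* b (+ a * + a) _) (sum-* b (- (+ 2 * + a * + b)) _))) (sum-* b (+ b * + b) _))) ⟩
    sum b (λ j → (+ a * + a * (+ j * + j) + (- (+ 2 * + a * + b)) * (+ j * quot a b j)) + + b * + b * (quot a b j * quot a b j))
      ≡⟨ sum-cong b (λ j _ → trans (lem₂ (+ a) (+ j) (+ b) (quot a b j)) (sym (cong₂ _*_ (rem-quot a b j) (rem-quot a b j)))) ⟩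
    sum b (λ j → rem a b j * rem a b j)
      ≡⟨ sum-permute-* a b (λ j → + j * + j) cop ⟩
    sum b (λ j → + j * + j) ∎
    where
    open ≡-Reasoning
    lem₁ : ∀ a q b f g → a * a * q - + 2 * a * b * f + b * b * g ≡ (a * a * q + (- (+ 2 * a * b)) * f) + b * b * g
    lem₁ = solve-∀
    lem₂ : ∀ a j b f → (a * a * (j * j) + (- (+ 2 * a * b)) * (j * f)) + b * b * (f * f) ≡ (a * j - b * f) * (a * j - b * f)
    lem₂ = solve-∀

  -- `sum-rem²` links `quotSum a b` to the sum of the squared quotients; `lattice-count` trades the
  -- latter for `quotSum b a` and the plain sum of the quotients, which `sum-rem` evaluates. The
  -- elimination produces b times the law.
  D-reciprocity : ∀ a b .{{_ : NonZero a}} .{{_ : NonZero b}} → Coprime a b →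
    + a * D a b + + b * D b a ≡ + a * + a + + b * + b + 1ℤ - + 3 * + a * + b
  D-reciprocity a b cop = ℤ.*-cancelˡ-≡ (+ b) _ _ (linear-combination
    (identity (+ a) (+ b) (quotSum a b) (quotSum b a) (sum b (λ j → + j)) (sum b (λ j → + j * + j))
              (sum b (quot a b)) (sum b (λ j → quot a b j * quot a b j)))
    (+ 6 · sum-rem² a b cop
     ⊕ - (+ 6 * + b * + b) · trans (sym (trans (sum-cong b (λ j _ → lem (quot a b j))) (sum-+ b _ _))) (lattice-count a b cop)
     ⊕ - (+ 6 * + b) · sum-rem a b cop
     ⊕ + 3 * + b * (+ a - 1ℤ) · 2*sum-id b
     ⊕ - (+ a * + a - 1ℤ) · 6*sum-sq b))
    where
    lem : ∀ x → x * (x + 1ℤ) ≡ x * x + x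
    lem = solve-∀
    identity : ∀ a b F F' S Q H G →
      b * (a * (+ 2 * a * (b - 1ℤ) * (+ 2 * b - 1ℤ) - + 12 * F - + 3 * b * (b - 1ℤ))
         + b * (+ 2 * b * (a - 1ℤ) * (+ 2 * a - 1ℤ) - + 12 * F' - + 3 * a * (a - 1ℤ)))
      - b * (a * a + b * b + 1ℤ - + 3 * a * b)
      ≡ + 6 * (a * a * Q - + 2 * a * b * F + b * b * G - Q)
        + - (+ 6 * b * b) * (G + H - ((b - 1ℤ) * (a * (a - 1ℤ)) - + 2 * F'))
        + - (+ 6 * b) * (a * S - b * H - S)
        + + 3 * b * (a - 1ℤ) * (+ 2 * S - b * (b - 1ℤ))
        + - (a * a - 1ℤ) * (+ 6 * Q - b * (b - 1ℤ) * (+ 2 * b - 1ℤ))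
    identity = solve-∀

  -- From rational Dedekind sums to the integer D.

  /-cross : ∀ i j m n .{{_ : NonZero m}} .{{_ : NonZero n}} → i * + n ≡ j * + m → i ℚ./ m ≡ j ℚ./ n
  /-cross i j (suc m) (suc n) e = ℚ.fromℚᵘ-cong {mkℚᵘ i m} {mkℚᵘ j n} (*≡* e)

  /-cross⁻¹ : ∀ i j m n .{{_ : NonZero m}} .{{_ : NonZero n}} → i ℚ./ m ≡ j ℚ./ n → i * + n ≡ j * + m
  /-cross⁻¹ i j (suc m) (suc n) e with ℚ./-injective-≃ (mkℚᵘ i m) (mkℚᵘ j n) e
  ... | *≡* e′ = e′

  toℚᵘ-/ : ∀ i n → toℚᵘ (i ℚ./ suc n) ≃ mkℚᵘ i n
  toℚᵘ-/ i n = ℚ.toℚᵘ-fromℚᵘ (mkℚᵘ i n)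

  +-/ : ∀ i j m n o .{{_ : NonZero m}} .{{_ : NonZero n}} .{{_ : NonZero o}} (k : ℤ) →
    (i * + n + j * + m) * + o ≡ k * (+ m * + n) → i ℚ./ m ℚ.+ j ℚ./ n ≡ k ℚ./ o
  +-/ i j (suc m) (suc n) (suc o) k e = ℚ.toℚᵘ-injective (begin
    toℚᵘ (i ℚ./ suc m ℚ.+ j ℚ./ suc n)             ≈⟨ ℚ.toℚᵘ-homo-+ (i ℚ./ suc m) (j ℚ./ suc n) ⟩
    toℚᵘ (i ℚ./ suc m) ℚᵘ.+ toℚᵘ (j ℚ./ suc n)     ≈⟨ ℚᵘ.+-cong (toℚᵘ-/ i m) (toℚᵘ-/ j n) ⟩
    mkℚᵘ i m ℚᵘ.+ mkℚᵘ j n                         ≈⟨ *≡* (trans e (cong (k *_) (sym (ℤ.pos-* (suc m) (suc n))))) ⟩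
    mkℚᵘ k o                                       ≈⟨ ℚᵘ.≃-sym (toℚᵘ-/ k o) ⟩
    toℚᵘ (k ℚ./ suc o)                             ∎)
    where open ℚᵘ.≃-Reasoning

  *-/ : ∀ i j m n o .{{_ : NonZero m}} .{{_ : NonZero n}} .{{_ : NonZero o}} (k : ℤ) →
    (i * j) * + o ≡ k * (+ m * + n) → i ℚ./ m ℚ.* (j ℚ./ n) ≡ k ℚ./ o
  *-/ i j (suc m) (suc n) (suc o) k e = ℚ.toℚᵘ-injective (begin
    toℚᵘ (i ℚ./ suc m ℚ.* (j ℚ./ suc n))           ≈⟨ ℚ.toℚᵘ-homo-* (i ℚ./ suc m) (j ℚ./ suc n) ⟩
    toℚᵘ (i ℚ./ suc m) ℚᵘ.* toℚᵘ (j ℚ./ suc n)     ≈⟨ ℚᵘ.*-cong (toℚᵘ-/ i m) (toℚᵘ-/ j n) ⟩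
    mkℚᵘ i m ℚᵘ.* mkℚᵘ j n                         ≈⟨ *≡* (trans e (cong (k *_) (sym (ℤ.pos-* (suc m) (suc n))))) ⟩
    mkℚᵘ k o                                       ≈⟨ ℚᵘ.≃-sym (toℚᵘ-/ k o) ⟩
    toℚᵘ (k ℚ./ suc o)                             ∎)
    where open ℚᵘ.≃-Reasoning

  sum-head : ∀ n f → sum (suc n) f ≡ f 0 + sum n (f ∘ suc)
  sum-head zero    f = ℤ.+-comm 0ℤ (f 0)
  sum-head (suc n) f = trans (cong (_+ f (suc n)) (sum-head n f)) (ℤ.+-assoc (f 0) _ _)

  sumℚ-/ : ∀ n (g : ℕ → ℚ) (t : ℕ → ℤ) d .{{_ : NonZero d}} → (∀ j → g j ≡ t j ℚ./ d) →
    sumℚ (applyUpTo g n) ≡ sum n t ℚ./ d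
  sumℚ-/ zero    g t d h = sym (ℚ.0/n≡0 d)
  sumℚ-/ (suc n) g t d h = trans (cong₂ ℚ._+_ (h 0) (sumℚ-/ n (g ∘ suc) (t ∘ suc) d (h ∘ suc)))
    (trans (+-/ (t 0) (sum n (t ∘ suc)) d d d (t 0 + sum n (t ∘ suc)) (lem (t 0) (sum n (t ∘ suc)) (+ d)))
           (cong (ℚ._/ d) (sym (sum-head n t))))
    where
    lem : ∀ x y d → (x * d + y * d) * d ≡ (x + y) * (d * d)
    lem = solve-∀

  %ℕ-unique : ∀ i b .{{_ : NonZero b}} r t → i ≡ + r + t * + b → r < b → i %ℕ b ≡ r
  %ℕ-unique i b r t i≡ r<b = ℤ.+-injective (ℤ.i-j≡0⇒i≡j (+ x) (+ r) (ℤ.∣i∣≡0⇒i≡0 (small ∣ + x - + r ∣ bound b∣)))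
    where
    x = i %ℕ b
    lem : ∀ x r s t b → x + s * b ≡ r + t * b → x - r ≡ (t - s) * b
    lem x r s t b e = linear-combination (id′ x r s t b) (1ℤ · e)
      where
      id′ : ∀ x r s t b → x - r - (t - s) * b ≡ 1ℤ * (x + s * b - (r + t * b))
      id′ = solve-∀
    b∣ : b ∣ ∣ + x - + r ∣
    b∣ = divides ∣ t - i /ℕ b ∣ (trans (cong ∣_∣ (lem (+ x) (+ r) (i /ℕ b) t (+ b)
           (trans (sym (ℤ.a≡a%ℕn+[a/ℕn]*n i b)) i≡))) (ℤ.∣i*j∣≡∣i∣*∣j∣ (t - i /ℕ b) (+ b)))
    bound : ∣ + x - + r ∣ < b
    bound = subst (λ z → ∣ z ∣ < b) (sym (ℤ.[+m]-[+n]≡m⊖n x r))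
              (ℕ.≤-<-trans (ℤ.∣m⊝n∣≤m⊔n x r) (ℕ.⊔-lub (ℤ.n%ℕd<d i b) r<b))
    small : ∀ n → n < b → b ∣ n → n ≡ 0
    small zero    _ _ = refl
    small (suc n) n<b b∣n = contradiction (∣⇒≤ b∣n) (ℕ.<⇒≱ n<b)

  private
    sawNum : ℕ → ℕ → ℤ
    sawNum zero    b = 0ℤ
    sawNum (suc r) b = + 2 * + suc r - + b

    -- The fixed denominator 2b lets the sum of products of sawtooth values be computed as a sum of
    -- integers over (2b)².
    saw-/ : ∀ n b .{{_ : NonZero b}} .{{_ : NonZero (2 ℕ.* b)}} → saw n b ≡ sawNum (n %ℕ b) b ℚ./ (2 ℕ.* b)
    saw-/ n b with n %ℕ b
    ... | zero  = sym (ℚ.0/n≡0 (2 ℕ.* b))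
    ... | suc r = +-/ (+ suc r) (- 1ℤ) b 2 (2 ℕ.* b) (+ 2 * + suc r - + b)
                    (trans (cong ((+ suc r * + 2 + - 1ℤ * + b) *_) (ℤ.pos-* 2 b)) (lem (+ suc r) (+ b)))
      where
      lem : ∀ r b → (r * + 2 + - 1ℤ * b) * (+ 2 * b) ≡ (+ 2 * r - b) * (b * + 2)
      lem = solve-∀

  remSum : ℕ → (b : ℕ) .{{_ : NonZero b}} → ℤ
  remSum a b = sum b (λ j → + j * rem a b j)

  -- In this form a enters only through the residues aj mod b, which gives periodicity, and the
  -- factors 12 and 3 are visible, which gives the congruences modulo 3, 4 and 8.
  b*D : ∀ a b .{{_ : NonZero b}} → + b * D a b ≡ + 12 * remSum a b - + 3 * + b * + b * (+ b - 1ℤ)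
  b*D a b = linear-combination (identity (+ a) (+ b) (quotSum a b) (sum b (λ j → + j * + j)) (remSum a b))
    (- (+ 12) · remSum-quotSum ⊕ - (+ 2 * + a) · 6*sum-sq b)
    where
    remSum-quotSum : remSum a b ≡ + a * sum b (λ j → + j * + j) + - + b * quotSum a b
    remSum-quotSum = trans (sum-cong b (λ j _ → trans (cong (+ j *_) (rem-quot a b j)) (lem (+ a) (+ j) (+ b) (quot a b j))))
      (trans (sum-+ b _ _) (cong₂ _+_ (sum-* b (+ a) _) (sum-* b (- + b) _)))
      where
      lem : ∀ a j b f → j * (a * j - b * f) ≡ a * (j * j) + - b * (j * f)
      lem = solve-∀
    identity : ∀ a b F Q P → b * (+ 2 * a * (b - 1ℤ) * (+ 2 * b - 1ℤ) - + 12 * F - + 3 * b * (b - 1ℤ))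
      - (+ 12 * P - + 3 * b * b * (b - 1ℤ))
      ≡ - (+ 12) * (P - (a * Q + - b * F)) + - (+ 2 * a) * (+ 6 * Q - b * (b - 1ℤ) * (+ 2 * b - 1ℤ))
    identity = solve-∀

  normDedekind-D : ∀ a b .{{_ : NonZero b}} a₀ t → a ≡ + a₀ + t * + b → Coprime a₀ b →
    normDedekind a b ≡ D a₀ b ℚ./ b
  normDedekind-D a b@(suc b-1) a₀ t a≡ cop = begin
    normDedekind a b
      ≡⟨ cong (λ l → (+ 12 ℚ./ 1) ℚ.* sumℚ l) (trans (sym (List.map-∘ {g = σ} {f = suc} (upTo b))) (List.map-upTo (σ ∘ suc) b)) ⟩
    (+ 12 ℚ./ 1) ℚ.* sumℚ (applyUpTo (σ ∘ suc) b)
      ≡⟨ cong ((+ 12 ℚ./ 1) ℚ.*_) (sumℚ-/ b (σ ∘ suc) (τ ∘ suc) d²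
           (λ j → trans (cong₂ ℚ._*_ (saw-/ (+ suc j) b) (trans (saw-/ (a * + suc j) b)
                    (cong (λ r → sawNum r b ℚ./ d) (residue (suc j)))))
                  (*-/ (sawNum (suc j % b) b) (sawNum ((a₀ ℕ.* suc j) % b) b) d d d² (τ (suc j))
                     (cong (τ (suc j) *_) (ℤ.pos-* d d))))) ⟩
    (+ 12 ℚ./ 1) ℚ.* (sum b (τ ∘ suc) ℚ./ d²)
      ≡⟨ *-/ (+ 12) (sum b (τ ∘ suc)) 1 d² b (D a₀ b) total ⟩
    D a₀ b ℚ./ b ∎
    where
    open ≡-Reasoning
    σ : ℕ → ℚ
    σ j = saw (+ j) b ℚ.* saw (a * + j) b
    d d² : ℕ
    d = 2 ℕ.* b
    d² = d ℕ.* d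
    τ : ℕ → ℤ
    τ j = sawNum (j % b) b * sawNum ((a₀ ℕ.* j) % b) b
    residue : ∀ j → (a * + j) %ℕ b ≡ (a₀ ℕ.* j) % b
    residue j = %ℕ-unique (a * + j) b _ (t * + j + + ((a₀ ℕ.* j) ℕ./ b)) (begin
      a * + j                                ≡⟨ cong (_* + j) a≡ ⟩
      (+ a₀ + t * + b) * + j                 ≡⟨ linear-combination (lem (+ a₀) t (+ b) (+ j) (quot a₀ b j) (rem a₀ b j)) (- 1ℤ · rem-quot a₀ b j) ⟩
      rem a₀ b j + (t * + j + quot a₀ b j) * + b ∎) (m%n<n (a₀ ℕ.* j) b)
      where
      lem : ∀ a t b j f r → (a + t * b) * j - (r + (t * j + f) * b) ≡ - 1ℤ * (r - (a * j - b * f))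
      lem = solve-∀
    -- This is (2j - b)(2r - b) expanded. At j = r = 0 the expansion is b² while the sawtooth is 0,
    -- hence the correction by -b².
    term : ∀ j → j < b → τ j ≡ ((+ 4 * (+ j * rem a₀ b j) + - (+ 2 * + b) * + j) + (- (+ 2 * + b) * rem a₀ b j + + b * + b))
                               + ind (j ℕ.≟ 0) * - (+ b * + b)
    term j j<b rewrite m<n⇒m%n≡m j<b = aux j j<b
      where
      zero-case : ∀ b r → 0ℤ * r ≡ ((+ 4 * (0ℤ * 0ℤ) + - (+ 2 * b) * 0ℤ) + (- (+ 2 * b) * 0ℤ + b * b)) + 1ℤ * - (b * b)
      zero-case = solve-∀
      suc-case : ∀ b j r → (+ 2 * j - b) * (+ 2 * r - b) ≡ ((+ 4 * (j * r) + - (+ 2 * b) * j) + (- (+ 2 * b) * r + b * b)) + 0ℤ * - (b * b)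
      suc-case = solve-∀
      aux : ∀ j → j < b → sawNum j b * sawNum ((a₀ ℕ.* j) % b) b ≡
        ((+ 4 * (+ j * rem a₀ b j) + - (+ 2 * + b) * + j) + (- (+ 2 * + b) * rem a₀ b j + + b * + b)) + ind (j ℕ.≟ 0) * - (+ b * + b)
      aux zero    _ rewrite ℕ.*-zeroʳ a₀ = zero-case (+ b) 0ℤ
      aux (suc j) 1+j<b with (a₀ ℕ.* suc j) % b in eq
      ... | zero  = contradiction (∣⇒≤ (coprime-divisor (Coprime.sym cop) (m%n≡0⇒n∣m (a₀ ℕ.* suc j) b eq))) (ℕ.<⇒≱ 1+j<b)
      ... | suc r = suc-case (+ b) (+ suc j) (+ suc r)
    τ-b : τ b ≡ 0ℤ
    τ-b = cong (λ r → sawNum r b * sawNum ((a₀ ℕ.* b) % b) b) (n%n≡0 b)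
    -- `dedekind` runs over j = 1, ..., b; the terms at 0 and b both vanish, so the range may be
    -- moved to 0, ..., b - 1.
    shift : sum b (τ ∘ suc) ≡ sum b τ
    shift = begin
      sum b (τ ∘ suc)        ≡⟨ sym (ℤ.+-identityˡ _) ⟩
      0ℤ + sum b (τ ∘ suc)   ≡⟨ sym (sum-head b τ) ⟩
      sum b τ + τ b          ≡⟨ cong (λ z → sum b τ + z) τ-b ⟩
      sum b τ + 0ℤ           ≡⟨ ℤ.+-identityʳ _ ⟩
      sum b τ                ∎
    sum-const : ∀ n c → sum n (λ _ → c) ≡ + n * c
    sum-const zero    c = refl
    sum-const (suc n) c = trans (cong (_+ c) (sum-const n c)) (lem (+ n) c)
      where
      lem : ∀ n c → n * c + c ≡ (1ℤ + n) * c
      lem = solve-∀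
    sum-τ : sum b (τ ∘ suc) ≡ ((+ 4 * remSum a₀ b + - (+ 2 * + b) * sum b (λ j → + j))
                               + (- (+ 2 * + b) * sum b (λ j → + j) + + b * (+ b * + b))) + - (+ b * + b)
    sum-τ = trans shift (trans (sum-cong b term) (trans (sum-+ b _ _) (cong₂ _+_
      (trans (sum-+ b _ _) (cong₂ _+_
        (trans (sum-+ b _ _) (cong₂ _+_ (sum-* b (+ 4) _) (sum-* b (- (+ 2 * + b)) _)))
        (trans (sum-+ b _ _) (cong₂ _+_ (trans (sum-* b (- (+ 2 * + b)) _) (cong (- (+ 2 * + b) *_) (sum-permute-* a₀ b +_ cop))) (sum-const b (+ b * + b))))))
      (sum-δ b 0 (λ _ → - (+ b * + b)) (s≤s z≤n)))))
    total : + 12 * sum b (τ ∘ suc) * + b ≡ D a₀ b * (+ 1 * + d²)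
    total = trans (linear-combination (identity (+ b) (D a₀ b) (sum b (τ ∘ suc)) (remSum a₀ b) (sum b (λ j → + j)))
      (+ 12 * + b · sum-τ ⊕ - (+ 24 * + b * + b) · 2*sum-id b ⊕ - (+ 4 * + b) · b*D a₀ b))
      (cong (λ z → D a₀ b * (+ 1 * z)) (sym (trans (ℤ.pos-* d d) (cong₂ _*_ (ℤ.pos-* 2 b) (ℤ.pos-* 2 b)))))
      where
      identity : ∀ b D T P S → + 12 * T * b - D * (+ 1 * ((+ 2 * b) * (+ 2 * b))) ≡
        + 12 * b * (T - (((+ 4 * P + - (+ 2 * b) * S) + (- (+ 2 * b) * S + b * (b * b))) + - (b * b)))
        + - (+ 24 * b * b) * (+ 2 * S - b * (b - 1ℤ))
        + - (+ 4 * b) * (b * D - (+ 12 * P - + 3 * b * b * (b - 1ℤ)))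
      identity = solve-∀

  -- Periodicity of D, and its vanishing for a² ≡ -1.

  D-cong : ∀ a a′ b .{{_ : NonZero b}} → (∀ j → (a ℕ.* j) % b ≡ (a′ ℕ.* j) % b) → D a b ≡ D a′ b
  D-cong a a′ b@(suc _) h = ℤ.*-cancelˡ-≡ (+ b) _ _ (trans (b*D a b) (trans
    (cong (λ P → + 12 * P - + 3 * + b * + b * (+ b - 1ℤ)) (sum-cong b (λ j _ → cong (λ r → + j * + r) (h j))))
    (sym (b*D a′ b))))

  D-+ : ∀ a b .{{_ : NonZero b}} → D (a ℕ.+ b) b ≡ D a b
  D-+ a b = D-cong (a ℕ.+ b) a b (λ j → trans (cong (_% b) (lem a b j)) ([m+kn]%n≡m%n (a ℕ.* j) j b))
    where
    lem : ∀ a b j → (a ℕ.+ b) ℕ.* j ≡ a ℕ.* j ℕ.+ j ℕ.* b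
    lem = ℕ-Solver.solve-∀

  -- A positive multiple of n below 2n can only be n.
  complement : ∀ n x y → n ∣ x ℕ.+ y → 0 < x → x < n → y < n → x ℕ.+ y ≡ n
  complement n x y (divides 0 e) 0<x x<n y<n = contradiction (ℕ.m+n≡0⇒m≡0 x e) (ℕ.>⇒≢ 0<x)
  complement n x y (divides 1 e) 0<x x<n y<n = trans e (ℕ.*-identityˡ n)
  complement n x y (divides (suc (suc i)) e) 0<x x<n y<n = contradiction (ℕ.+-mono-< x<n y<n)
    (ℕ.≤⇒≯ (subst (n ℕ.+ n ≤_) (sym e) (ℕ.+-monoʳ-≤ n (ℕ.m≤m+n n (i ℕ.* n)))))

  0<rem : ∀ a b .{{_ : NonZero b}} → Coprime a b → ∀ j → 0 < j → j < b → 0 < (a ℕ.* j) % b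
  0<rem a b cop j 0<j j<b = ℕ.n≢0⇒n>0 (λ e → ℕ.<⇒≱ j<b
    (∣⇒≤ {{ℕ.>-nonZero 0<j}} (coprime-divisor (Coprime.sym cop) (m%n≡0⇒n∣m (a ℕ.* j) b e))))

  %-+-∣ : ∀ x y n .{{_ : NonZero n}} → n ∣ x ℕ.+ y → n ∣ x % n ℕ.+ y % n
  %-+-∣ x y n n∣ = m%n≡0⇒n∣m _ n (trans (sym (%-distribˡ-+ x y n)) (n∣m⇒m%n≡0 (x ℕ.+ y) n n∣))

  rem-reflect : ∀ a b .{{_ : NonZero b}} → Coprime a b → ∀ i j → suc i ℕ.+ suc j ≡ b →
    (a ℕ.* suc i) % b ℕ.+ (a ℕ.* suc j) % b ≡ b
  rem-reflect a b cop i j e = complement b _ _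
    (%-+-∣ (a ℕ.* suc i) (a ℕ.* suc j) b (divides a (trans (sym (ℕ.*-distribˡ-+ a (suc i) (suc j))) (cong (a ℕ.*_) e))))
    (0<rem a b cop (suc i) (s≤s z≤n) (subst (suc i <_) e (ℕ.m<m+n (suc i) (s≤s z≤n))))
    (m%n<n (a ℕ.* suc i) b) (m%n<n (a ℕ.* suc j) b)

  -- Since a² ≡ -1, the substitution j ↦ aj turns j · (aj mod g) into (aj mod g) · (g - j).
  D-self-inverse : ∀ a g h .{{_ : NonZero g}} → Coprime a g → a ℕ.* a ℕ.+ 1 ≡ h ℕ.* g → D a g ≡ 0ℤ
  D-self-inverse a g@(suc _) h cop e = ℤ.*-cancelˡ-≡ (+ g) _ _ (linear-combination
    (identity (+ g) (D a g) (remSum a g) (sum g (λ j → + j)))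
    (1ℤ · b*D a g ⊕ + 6 · reflect ⊕ + 3 * + g · 2*sum-id g))
    where
    identity : ∀ g D P S → g * D - g * 0ℤ ≡ 1ℤ * (g * D - (+ 12 * P - + 3 * g * g * (g - 1ℤ)))
      + + 6 * (P - (g * S + - 1ℤ * P)) + + 3 * g * (+ 2 * S - g * (g - 1ℤ))
    identity = solve-∀
    step : ∀ j → j < g → rem a g j * rem a g ((a ℕ.* j) % g) ≡ + g * rem a g j + - 1ℤ * (+ j * rem a g j)
    step zero j<g rewrite ℕ.*-zeroʳ a = sym (lem (+ g))
      where
      lem : ∀ x → x * 0ℤ + - 1ℤ * (0ℤ * 0ℤ) ≡ 0ℤ * 0ℤ
      lem = solve-∀
    step j@(suc _) j<g = linear-combination (lem (rem a g j) (+ g) (+ j) (rem a g ((a ℕ.* j) % g)))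
      (rem a g j · cong +_ sum≡g)
      where
      lem : ∀ r g j s → r * s - (g * r + - 1ℤ * (j * r)) ≡ r * (j + s - g)
      lem = solve-∀
      ring : ∀ a j → j ℕ.+ a ℕ.* (a ℕ.* j) ≡ (a ℕ.* a ℕ.+ 1) ℕ.* j
      ring = ℕ-Solver.solve-∀
      ring′ : ∀ h g j → h ℕ.* g ℕ.* j ≡ h ℕ.* j ℕ.* g
      ring′ = ℕ-Solver.solve-∀
      sum≡g : j ℕ.+ (a ℕ.* ((a ℕ.* j) % g)) % g ≡ g
      sum≡g = complement g j _
        (subst₂ (λ x y → g ∣ x ℕ.+ y) (m<n⇒m%n≡m j<g) (sym (*-%-assocʳ a (a ℕ.* j) g))
          (%-+-∣ j (a ℕ.* (a ℕ.* j)) g (divides (h ℕ.* j) (trans (ring a j) (trans (cong (ℕ._* j) e) (ring′ h g j))))))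
        (s≤s z≤n) j<g (m%n<n (a ℕ.* ((a ℕ.* j) % g)) g)
    reflect : remSum a g ≡ + g * sum g (λ j → + j) + - 1ℤ * remSum a g
    reflect = begin
      remSum a g                                              ≡⟨ sym (sum-permute-* a g (λ j → + j * rem a g j) cop) ⟩
      sum g (λ j → rem a g j * rem a g ((a ℕ.* j) % g))       ≡⟨ sum-cong g step ⟩
      sum g (λ j → + g * rem a g j + - 1ℤ * (+ j * rem a g j)) ≡⟨ trans (sum-+ g _ _) (cong₂ _+_ (sum-* g (+ g) _) (sum-* g (- 1ℤ) _)) ⟩
      + g * sum g (rem a g) + - 1ℤ * remSum a g               ≡⟨ cong (λ z → + g * z + - 1ℤ * remSum a g) (sum-permute-* a g +_ cop) ⟩
      + g * sum g (λ j → + j) + - 1ℤ * remSum a g             ∎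
      where open ≡-Reasoning

  -- Congruences for D modulo 3, 4 and 8.

  prime-∣-cancel : ∀ {p} → Prime p → ∀ a x → ¬ (p ∣ a) → + p ℤ∣.∣ + a * x → + p ℤ∣.∣ x
  prime-∣-cancel pr a x p∤a p∣ax with euclidsLemma a ∣ x ∣ pr (subst (_ ∣_) (ℤ.∣i*j∣≡∣i∣*∣j∣ (+ a) x) (ℤ∣.∣⇒∣ᵤ p∣ax))
  ... | inj₁ p∣a = contradiction p∣a p∤a
  ... | inj₂ p∣x = ℤ∣.∣ᵤ⇒∣ p∣x

  Odd : ℕ → Set
  Odd n = ∃[ i ] n ≡ 2 ℕ.* i ℕ.+ 1

  Odd-+ : ∀ n i → n ≡ 2 ℕ.* i ℕ.+ 1 → + n ≡ + 2 * + i + 1ℤ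
  Odd-+ n i e = trans (cong +_ e) (trans (ℤ.pos-+ (2 ℕ.* i) 1) (cong (_+ 1ℤ) (ℤ.pos-* 2 i)))

  n*[n+1]-even : ∀ n → ∃[ s ] + n * (+ n + 1ℤ) ≡ + 2 * s
  n*[n+1]-even n = sum (suc n) (λ j → + j) , trans (lem (+ n)) (sym (2*sum-id (suc n)))
    where
    lem : ∀ x → x * (x + 1ℤ) ≡ (1ℤ + x) * (1ℤ + x - 1ℤ)
    lem = solve-∀

  -- An odd a is its own inverse modulo 8: a² - 1 = 4 i (i + 1), and i (i + 1) is even.
  odd-cancel-8 : ∀ a x → Odd a → + 8 ℤ∣.∣ + a * x → + 8 ℤ∣.∣ x
  odd-cancel-8 a x (i , e) (ℤ∣.divides t ax≡) with n*[n+1]-even i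
  ... | s , s≡ = ℤ∣.divides (+ a * t - s * x) (linear-combination (identity (+ a) x (+ i) t s)
                   (+ a · ax≡ ⊕ - x * (+ a + + 2 * + i + 1ℤ) · Odd-+ a i e ⊕ - (+ 4 * x) · s≡))
    where
    identity : ∀ a x i t s → x - (a * t - s * x) * + 8 ≡
      a * (a * x - t * + 8) + - x * (a + + 2 * i + 1ℤ) * (a - (+ 2 * i + 1ℤ)) + - (+ 4 * x) * (i * (i + 1ℤ) - + 2 * s)
    identity = solve-∀

  odd-cancel-4 : ∀ a x → Odd a → + 4 ℤ∣.∣ + a * x → + 4 ℤ∣.∣ x
  odd-cancel-4 a x (i , e) (ℤ∣.divides t ax≡) = ℤ∣.divides (+ a * t - + i * (+ i + 1ℤ) * x)
    (linear-combination (identity (+ a) x (+ i) t) (+ a · ax≡ ⊕ - x * (+ a + + 2 * + i + 1ℤ) · Odd-+ a i e))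
    where
    identity : ∀ a x i t → x - (a * t - i * (i + 1ℤ) * x) * + 4 ≡
      a * (a * x - t * + 4) + - x * (a + + 2 * i + 1ℤ) * (a - (+ 2 * i + 1ℤ))
    identity = solve-∀

  3-prime : Prime 3
  3-prime = from-yes (prime? 3)

  D-mod-3 : ∀ c a .{{_ : NonZero a}} → ¬ (3 ∣ a) → + 3 ℤ∣.∣ D c a
  D-mod-3 c a 3∤a = prime-∣-cancel 3-prime a (D c a) 3∤a
    (ℤ∣.divides (+ 4 * remSum c a - + a * + a * (+ a - 1ℤ)) (trans (b*D c a) (lem (remSum c a) (+ a))))
    where
    lem : ∀ P a → + 12 * P - + 3 * a * a * (a - 1ℤ) ≡ (+ 4 * P - a * a * (a - 1ℤ)) * + 3
    lem = solve-∀

  -- Modulo 4, `b*D` reads a D ≡ a² (a - 1), and a² (a - 1) - a (a - 1) = a (a - 1)² is a multiple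
  -- of 4.
  D-mod-4 : ∀ c a .{{_ : NonZero a}} → Odd a → + 4 ℤ∣.∣ D c a - (+ a - 1ℤ)
  D-mod-4 c a odd@(i , e) = odd-cancel-4 a _ odd (ℤ∣.divides (+ 3 * remSum c a - + a * + i * (+ 3 * + i + + 2))
    (linear-combination (identity (+ a) (+ i) (D c a) (remSum c a))
      (1ℤ · b*D c a ⊕ - (+ a * (+ 3 * + a + + 6 * + i + 1ℤ)) · Odd-+ a i e)))
    where
    identity : ∀ a i D P → a * (D - (a - 1ℤ)) - (+ 3 * P - a * i * (+ 3 * i + + 2)) * + 4 ≡
      1ℤ * (a * D - (+ 12 * P - + 3 * a * a * (a - 1ℤ))) + - (a * (+ 3 * a + + 6 * i + 1ℤ)) * (a - (+ 2 * i + 1ℤ))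
    identity = solve-∀

  -- The first and the last term agree; removing both leaves a shorter sum with the same symmetry.
  sum-symmetric-even : ∀ i u → (∀ j j′ → suc (j ℕ.+ j′) ≡ 2 ℕ.* i → u j ≡ u j′) → ∃[ s ] sum (2 ℕ.* i) u ≡ + 2 * s
  sum-symmetric-even zero    u sym-u = 0ℤ , refl
  sum-symmetric-even (suc i) u sym-u with sum-symmetric-even i (u ∘ suc)
    (λ j j′ e → sym-u (suc j) (suc j′) (trans (cong suc (cong suc (ℕ.+-suc j j′))) (trans (cong (suc ∘ suc) e) (sym 2+))))
    where
    2+ : 2 ℕ.* suc i ≡ suc (suc (2 ℕ.* i))
    2+ = ℕ.*-suc 2 i
  ... | s , e = s + u 0 , (begin
    sum (2 ℕ.* suc i) u                              ≡⟨ cong (λ n → sum n u) (ℕ.*-suc 2 i) ⟩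
    sum (suc (2 ℕ.* i)) u + u (suc (2 ℕ.* i))        ≡⟨ cong₂ _+_ (trans (sum-head (2 ℕ.* i) u) (cong (λ z → u 0 + z) e))
                                                          (sym (sym-u 0 (suc (2 ℕ.* i)) (sym (ℕ.*-suc 2 i)))) ⟩
    u 0 + + 2 * s + u 0                              ≡⟨ lem (u 0) s ⟩
    + 2 * (s + u 0)                                  ∎)
    where
    open ≡-Reasoning
    lem : ∀ x s → x + + 2 * s + x ≡ + 2 * (s + x)
    lem = solve-∀

  -- A substitute for `remSum` that is additive modulo 4 when multipliers are multiplied; see
  -- `displacement-remSum` and `displacement-*`.
  displacement : ℕ → (a : ℕ) .{{_ : NonZero a}} → ℤ
  displacement c a = sum a (λ j → (+ j - rem c a j) * (+ j - rem c a j))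

  displacement-remSum : ∀ c a .{{_ : NonZero a}} → Coprime c a →
    displacement c a ≡ + 2 * sum a (λ j → + j * + j) - + 2 * remSum c a
  displacement-remSum c a cop = begin
    displacement c a
      ≡⟨ sum-cong a (λ j _ → lem₁ (+ j) (rem c a j)) ⟩
    sum a (λ j → (+ j * + j + rem c a j * rem c a j) + - (+ 2) * (+ j * rem c a j))
      ≡⟨ trans (sum-+ a _ _) (cong₂ _+_ (trans (sum-+ a _ _) (cong (λ z → Q + z) (sum-permute-* c a (λ j → + j * + j) cop))) (sum-* a (- (+ 2)) _)) ⟩
    (Q + Q) + - (+ 2) * remSum c a
      ≡⟨ lem₂ Q (remSum c a) ⟩
    + 2 * Q - + 2 * remSum c a ∎
    where
    open ≡-Reasoning
    Q = sum a (λ j → + j * + j)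
    lem₁ : ∀ j r → (j - r) * (j - r) ≡ (j * j + r * r) + - (+ 2) * (j * r)
    lem₁ = solve-∀
    lem₂ : ∀ q p → (q + q) + - (+ 2) * p ≡ + 2 * q - + 2 * p
    lem₂ = solve-∀

  -- Gauss's lemma in disguise: both factors of the cross term are odd functions of j,
  -- so its sum over the nonzero residues is even.
  displacement-* : ∀ c d a .{{_ : NonZero a}} → Odd a → Coprime c a → Coprime d a → Coprime (c ℕ.* d) a →
    ∃[ s ] displacement (c ℕ.* d) a ≡ displacement c a + displacement d a + + 4 * s
  displacement-* c d a (i , a≡) copc copd copcd = s , (begin
    displacement (c ℕ.* d) a
      ≡⟨ sum-cong a (λ j _ → trans (cong (λ z → (+ j - z) * (+ j - z)) (rem-* j)) (lem₁ (+ j) (rem d a j) (rem c a ((d ℕ.* j) % a)))) ⟩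
    sum a (λ j → (square c ((d ℕ.* j) % a) + square d j) + + 2 * cross j)
      ≡⟨ trans (sum-+ a _ _) (cong₂ _+_ (trans (sum-+ a _ _) (cong (_+ displacement d a) (sum-permute-* d a (square c) copd))) (sum-* a (+ 2) cross)) ⟩
    (displacement c a + displacement d a) + + 2 * sum a cross
      ≡⟨ cong (λ z → displacement c a + displacement d a + + 2 * z) cross-even ⟩
    (displacement c a + displacement d a) + + 2 * (+ 2 * s)
      ≡⟨ lem₂ (displacement c a + displacement d a) s ⟩
    displacement c a + displacement d a + + 4 * s ∎)
    where
    open ≡-Reasoning
    square : ℕ → ℕ → ℤ
    square c j = (+ j - rem c a j) * (+ j - rem c a j)
    cross : ℕ → ℤ
    cross j = (+ j - rem d a j) * (rem d a j - rem c a ((d ℕ.* j) % a))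
    rem-* : ∀ j → rem (c ℕ.* d) a j ≡ rem c a ((d ℕ.* j) % a)
    rem-* j = cong +_ (trans (cong (_% a) (ℕ.*-assoc c d j)) (sym (*-%-assocʳ c (d ℕ.* j) a)))
    lem₁ : ∀ j r s → (j - s) * (j - s) ≡ ((r - s) * (r - s) + (j - r) * (j - r)) + + 2 * ((j - r) * (r - s))
    lem₁ = solve-∀
    lem₂ : ∀ x s → x + + 2 * (+ 2 * s) ≡ x + + 4 * s
    lem₂ = solve-∀
    cross-0 : cross 0 ≡ 0ℤ
    cross-0 rewrite ℕ.*-zeroʳ d | m<n⇒m%n≡m (ℕ.>-nonZero⁻¹ a) = refl
    cross-sym : ∀ j j′ → suc (j ℕ.+ j′) ≡ 2 ℕ.* i → cross (suc j) ≡ cross (suc j′)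
    cross-sym j j′ e = linear-combination
      (identity (+ suc j) (rem d a (suc j)) (rem c a ((d ℕ.* suc j) % a)) (+ suc j′) (rem d a (suc j′)) (rem c a ((d ℕ.* suc j′) % a)) (+ a))
      ((r₁ - s₁) · cong +_ j+j′ ⊕ (s₁ - r₁ - (+ suc j′ - r₂)) · cong +_ (rem-reflect d a copd j j′ j+j′)
        ⊕ (+ suc j′ - r₂) · trans (cong₂ _+_ (sym (rem-* (suc j))) (sym (rem-* (suc j′)))) (cong +_ (rem-reflect (c ℕ.* d) a copcd j j′ j+j′)))
      where
      r₁ = rem d a (suc j)
      r₂ = rem d a (suc j′)
      s₁ = rem c a ((d ℕ.* suc j) % a)
      j+j′ : suc j ℕ.+ suc j′ ≡ a
      j+j′ = trans (cong suc (ℕ.+-suc j j′)) (trans (cong suc e) (trans (ℕ.+-comm 1 (2 ℕ.* i)) (sym a≡)))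
      identity : ∀ j r s j′ r′ s′ a → (j - r) * (r - s) - (j′ - r′) * (r′ - s′) ≡
        (r - s) * (j + j′ - a) + (s - r - (j′ - r′)) * (r + r′ - a) + (j′ - r′) * (s + s′ - a)
      identity = solve-∀
    even : ∃[ s ] sum (2 ℕ.* i) (cross ∘ suc) ≡ + 2 * s
    even = sum-symmetric-even i (cross ∘ suc) cross-sym
    s = proj₁ even
    cross-even : sum a cross ≡ + 2 * s
    cross-even = begin
      sum a cross                              ≡⟨ cong (λ n → sum n cross) (trans a≡ (ℕ.+-comm (2 ℕ.* i) 1)) ⟩
      sum (suc (2 ℕ.* i)) cross                ≡⟨ sum-head (2 ℕ.* i) cross ⟩
      cross 0 + sum (2 ℕ.* i) (cross ∘ suc)    ≡⟨ cong₂ _+_ cross-0 (proj₂ even) ⟩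
      0ℤ + + 2 * s                             ≡⟨ ℤ.+-identityˡ _ ⟩
      + 2 * s                                  ∎

  coprime-*ˡ : ∀ m n {k} → Coprime (m ℕ.* n) k → Coprime m k
  coprime-*ˡ m n cop (d∣m , d∣k) = cop (ℕ∣.∣m⇒∣m*n n d∣m , d∣k)

  coprime-*ʳ : ∀ m n {k} → Coprime (m ℕ.* n) k → Coprime n k
  coprime-*ʳ m n cop (d∣n , d∣k) = cop (ℕ∣.∣n⇒∣m*n m d∣n , d∣k)

  private
    parity-identity : ∀ Q P P′ R s t → + 2 * (P - P′) - + 2 * (+ 2 * - (Q - R + s + t)) ≡
      - 1ℤ * (+ 2 * Q - + 2 * P - ((+ 2 * Q - + 2 * P′) + ((+ 2 * Q - + 2 * R) + (+ 2 * Q - + 2 * R) + + 4 * t) + + 4 * s))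
    parity-identity = solve-∀

    parity : ∀ Q P P′ R s t {E E′ E″ F} → E ≡ E′ + E″ + + 4 * s → E″ ≡ F + F + + 4 * t →
      E ≡ + 2 * Q - + 2 * P → E′ ≡ + 2 * Q - + 2 * P′ → F ≡ + 2 * Q - + 2 * R → P - P′ ≡ + 2 * - (Q - R + s + t)
    parity Q P P′ R s t e refl refl refl refl = ℤ.*-cancelˡ-≡ (+ 2) _ _ (linear-combination (parity-identity Q P P′ R s t) (- 1ℤ · e))

  -- Modulo 4 the displacement of c m² is that of c plus twice that of m, and every displacement is
  -- even. So c and c m² have the same displacement modulo 4, and halving gives the parity.
  remSum-parity : ∀ c m a .{{_ : NonZero a}} → Odd a → Coprime (c ℕ.* (m ℕ.* m)) a →
    ∃[ s ] remSum (c ℕ.* (m ℕ.* m)) a - remSum c a ≡ + 2 * s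
  remSum-parity c m a odd cop = _ , parity (sum a (λ j → + j * + j)) (remSum (c ℕ.* (m ℕ.* m)) a) (remSum c a) (remSum m a) _ _
    (proj₂ (displacement-* c (m ℕ.* m) a odd copc copm² cop)) (proj₂ (displacement-* m m a odd copm copm copm²))
    (displacement-remSum (c ℕ.* (m ℕ.* m)) a cop) (displacement-remSum c a copc) (displacement-remSum m a copm)
    where
    copc : Coprime c a
    copc = coprime-*ˡ c (m ℕ.* m) cop
    copm² : Coprime (m ℕ.* m) a
    copm² = coprime-*ʳ c (m ℕ.* m) cop
    copm : Coprime m a
    copm = coprime-*ˡ m m copm²

  -- Two instances of `b*D` differ by 12 times the difference of the `remSum`s, which is even by
  -- `remSum-parity`.
  D-mod-8 : ∀ c m a .{{_ : NonZero a}} → Odd a → Coprime (c ℕ.* (m ℕ.* m)) a → + 8 ℤ∣.∣ D (c ℕ.* (m ℕ.* m)) a - D c a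
  D-mod-8 c m a odd cop = odd-cancel-8 a _ odd
    (lem (D (c ℕ.* (m ℕ.* m)) a) (D c a) (remSum (c ℕ.* (m ℕ.* m)) a) (remSum c a) (b*D (c ℕ.* (m ℕ.* m)) a) (b*D c a) (remSum-parity c m a odd cop))
    where
    identity : ∀ a D D′ P P′ s → a * (D - D′) - (+ 3 * s) * + 8 ≡
      1ℤ * (a * D - (+ 12 * P - + 3 * a * a * (a - 1ℤ))) + - 1ℤ * (a * D′ - (+ 12 * P′ - + 3 * a * a * (a - 1ℤ)))
      + + 12 * (P - P′ - + 2 * s)
    identity = solve-∀
    lem : ∀ D D′ P P′ → + a * D ≡ + 12 * P - + 3 * + a * + a * (+ a - 1ℤ) → + a * D′ ≡ + 12 * P′ - + 3 * + a * + a * (+ a - 1ℤ) →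
      (∃[ s ] P - P′ ≡ + 2 * s) → + 8 ℤ∣.∣ + a * (D - D′)
    lem D D′ P P′ e e′ (s , f) = ℤ∣.divides (+ 3 * s) (linear-combination (identity (+ a) D D′ P P′ s) (1ℤ · e ⊕ - 1ℤ · e′ ⊕ + 12 · f))

  -- Necessity of the congruence conditions.

  -- Since `D a g` vanishes, the two reciprocity laws differ by an equation all of whose terms carry
  -- a factor g, which is cancelled. What remains involves only D with second argument a, whose
  -- congruences are known.
  numerator-identity : ∀ a g q h k .{{_ : NonZero a}} .{{_ : NonZero g}} .{{_ : NonZero (g ℕ.* q)}} →
    Coprime a (g ℕ.* q) → a ℕ.* a ℕ.+ 1 ≡ h ℕ.* g → D a (g ℕ.* q) ≡ k * + g →
    + a * k ≡ D g a - + q * D (g ℕ.* q) a + + g * (+ q * + q - 1ℤ) - + 3 * + a * (+ q - 1ℤ)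
  numerator-identity a g@(suc _) q h k cop a²+1≡ D≡ = ℤ.*-cancelˡ-≡ (+ g) _ _
    (combine (+ a) (+ g) (+ q) (+ (g ℕ.* q)) k (D (g ℕ.* q) a) (D g a) (ℤ.pos-* g q) (trans (cong (λ z → + a * z + + (g ℕ.* q) * D (g ℕ.* q) a) (sym D≡)) (D-reciprocity a (g ℕ.* q) cop))
      (trans (cong (λ z → + a * z + + g * D g a) (sym (D-self-inverse a g h copg a²+1≡))) (D-reciprocity a g copg)))
    where
    copg : Coprime a g
    copg (d∣a , d∣g) = cop (d∣a , ℕ∣.∣m⇒∣m*n q d∣g)
    combine : ∀ A G Q B k x y → B ≡ G * Q → A * (k * G) + B * x ≡ A * A + B * B + 1ℤ - + 3 * A * B →
      A * 0ℤ + G * y ≡ A * A + G * G + 1ℤ - + 3 * A * G →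
      G * (A * k) ≡ G * (y - Q * x + G * (Q * Q - 1ℤ) - + 3 * A * (Q - 1ℤ))
    combine A G Q _ k x y refl e f = linear-combination (identity A G Q k x y) (1ℤ · e ⊕ - 1ℤ · f)
      where
      identity : ∀ A G Q k x y → G * (A * k) - G * (y - Q * x + G * (Q * Q - 1ℤ) - + 3 * A * (Q - 1ℤ)) ≡
        1ℤ * (A * (k * G) + G * Q * x - (A * A + G * Q * (G * Q) + 1ℤ - + 3 * A * (G * Q)))
        + - 1ℤ * (A * 0ℤ + G * y - (A * A + G * G + 1ℤ - + 3 * A * G))
      identity = solve-∀

  -- As k is prime to q, q divides b = gq. With D = kg in the reciprocity law, every term outside a²
  -- + 1 is visibly divisible by g; `X` is the resulting cofactor.
  denominator-shape : ∀ a b q k .{{_ : NonZero a}} .{{_ : NonZero b}} .{{_ : NonZero q}} → Coprime a b → Coprime ∣ k ∣ q →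
    D a b * + q ≡ k * + b → ∃[ g ] ∃[ h ] b ≡ g ℕ.* q × a ℕ.* a ℕ.+ 1 ≡ h ℕ.* g × D a b ≡ k * + g
  denominator-shape a b q@(suc _) k cop copk Dq≡kb = shape q∣b
    where
    q∣b : q ∣ b
    q∣b = coprime-divisor (Coprime.sym copk) (divides ∣ D a b ∣ (trans (sym (ℤ.∣i*j∣≡∣i∣*∣j∣ k (+ b)))
            (trans (cong ∣_∣ (sym Dq≡kb)) (ℤ.∣i*j∣≡∣i∣*∣j∣ (D a b) (+ q)))))
    shape : q ∣ b → ∃[ g ] ∃[ h ] b ≡ g ℕ.* q × a ℕ.* a ℕ.+ 1 ≡ h ℕ.* g × D a b ≡ k * + g
    shape (divides g b≡) = g , h , b≡ , trans (cong ∣_∣ a²+1≡) (ℤ.∣i*j∣≡∣i∣*∣j∣ X (+ g)) , D≡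
      where
      +b≡ : + b ≡ + g * + q
      +b≡ = trans (cong +_ b≡) (ℤ.pos-* g q)
      D≡ : D a b ≡ k * + g
      D≡ = ℤ.*-cancelʳ-≡ (D a b) (k * + g) (+ q) (trans Dq≡kb (trans (cong (k *_) +b≡) (sym (ℤ.*-assoc k (+ g) (+ q)))))
      X : ℤ
      X = + a * k + + q * D b a - + q * + b + + 3 * + a * + q
      -- `X` is known only as an integer; as a² + 1 and g are natural, its absolute value serves as
      -- well.
      h : ℕ
      h = ∣ X ∣
      identity : ∀ A G Q B k d x → A * A + 1ℤ - (A * k + Q * x - Q * B + + 3 * A * Q) * G ≡
        - 1ℤ * (A * d + B * x - (A * A + B * B + 1ℤ - + 3 * A * B)) + A * (d - k * G) + (x - B + + 3 * A) * (B - G * Q)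
      identity = solve-∀
      factor : ∀ {A G Q B k d x} → A * d + B * x ≡ A * A + B * B + 1ℤ - + 3 * A * B → d ≡ k * G → B ≡ G * Q →
        A * A + 1ℤ ≡ (A * k + Q * x - Q * B + + 3 * A * Q) * G
      factor {A} {G} {Q} {B} {k} {d} {x} e₁ e₂ e₃ = linear-combination (identity A G Q B k d x) (- 1ℤ · e₁ ⊕ A · e₂ ⊕ (x - B + + 3 * A) · e₃)
      a²+1≡ : + (a ℕ.* a ℕ.+ 1) ≡ X * + g
      a²+1≡ = trans (trans (ℤ.pos-+ (a ℕ.* a) 1) (cong (_+ 1ℤ) (ℤ.pos-* a a)))
        (factor {+ a} {+ g} {+ q} {+ b} {k} {D a b} {D b a} (D-reciprocity a b cop) D≡ +b≡)

  -- p cannot divide both a and b, and passing from a to a + b does not change D.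
  avoid-prime : ∀ p → Prime p → ∀ a b .{{_ : NonZero b}} → Coprime a b →
    ∃[ a′ ] ¬ (p ∣ a′) × Coprime a′ b × D a′ b ≡ D a b
  avoid-prime p pr a b cop with p ∣? a
  ... | no p∤a = a , p∤a , cop , refl
  ... | yes p∣a = a ℕ.+ b , (λ p∣a+b → contradiction (cop (p∣a , ℕ∣.∣m+n∣m⇒∣n p∣a+b p∣a)) (ℕ.nonTrivial⇒≢1 {{prime⇒nonTrivial pr}}))
     , (λ {d} (d∣a+b , d∣b) → cop (ℕ∣.∣m+n∣m⇒∣n (subst (d ∣_) (ℕ.+-comm a b) d∣a+b) d∣b , d∣b)) , D-+ a b

  ∤⇒nonZero : ∀ {p a} → ¬ (p ∣ a) → NonZero a
  ∤⇒nonZero {a = zero}  p∤a = contradiction (_ ℕ∣.∣0) p∤a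
  ∤⇒nonZero {a = suc _} p∤a = _

  2∤⇒Odd : ∀ n → ¬ (2 ∣ n) → Odd n
  2∤⇒Odd n 2∤n with n % 2 in eq | m%n<n n 2 | m≡m%n+[m/n]*n n 2
  ... | 0 | _ | _ = contradiction (m%n≡0⇒n∣m n 2 eq) 2∤n
  ... | 1 | _ | e = n ℕ./ 2 , trans e (trans (ℕ.+-comm 1 (n ℕ./ 2 ℕ.* 2)) (cong (ℕ._+ 1) (ℕ.*-comm (n ℕ./ 2) 2)))
  ... | suc (suc _) | s≤s (s≤s ()) | _

  -- S(a, b) = k/q with denominators cleared and a natural. `dedekind⇒value` and `value⇒dedekind`
  -- relate it to the rational form.
  Value : ℕ → ℤ → Set
  Value q k = ∃[ a ] ∃[ b ] Σ (NonZero b) λ nz → Coprime a b × D a b {{nz}} * + q ≡ k * + b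

  -- All that the congruence arguments retain of a value: the formula for a k, with a prime to p so
  -- that it cancels modulo powers of p.
  Normalised : ℕ → ℕ → ℤ → Set
  Normalised p q k = ∃[ a ] ∃[ g ] Σ (NonZero a) λ nz → ¬ (p ∣ a) × Coprime (g ℕ.* q) a ×
    + a * k ≡ D g a {{nz}} - + q * D (g ℕ.* q) a {{nz}} + + g * (+ q * + q - 1ℤ) - + 3 * + a * (+ q - 1ℤ)

  normalise : ∀ p → Prime p → ∀ q k .{{_ : NonZero q}} → Coprime ∣ k ∣ q → Value q k → Normalised p q k
  normalise p prime-p q k copk (a₀ , b , nzb , cop₀ , e) = choose (avoid-prime p prime-p a₀ b {{nzb}} cop₀)
    where
    choose : (∃[ a ] ¬ (p ∣ a) × Coprime a b × D a b {{nzb}} ≡ D a₀ b {{nzb}}) → Normalised p q k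
    choose (a , p∤a , cop , D≡) = go (denominator-shape a b q k {{nza}} {{nzb}} cop copk (trans (cong (_* + q) D≡) e))
      where
      nza = ∤⇒nonZero p∤a
      go : (∃[ g ] ∃[ h ] b ≡ g ℕ.* q × a ℕ.* a ℕ.+ 1 ≡ h ℕ.* g × D a b {{nzb}} ≡ k * + g) → Normalised p q k
      go (g , h , refl , a²+1≡ , Dab≡) = a , g , nza , p∤a , Coprime.sym cop ,
        numerator-identity a g q h k {{nza}} {{ℕ.m*n≢0⇒m≢0 g {{nzb}}}} {{nzb}} cop a²+1≡ Dab≡

  3∤⇒3∣q²-1 : ∀ q → ¬ (3 ∣ q) → + 3 ℤ∣.∣ + q * + q - 1ℤ
  3∤⇒3∣q²-1 q 3∤q with q % 3 in eq | m%n<n q 3 | m≡m%n+[m/n]*n q 3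
  ... | 0 | _ | _ = contradiction (m%n≡0⇒n∣m q 3 eq) 3∤q
  ... | 1 | _ | e = ℤ∣.divides (+ 3 * i * i + + 2 * i) (trans (cong (λ z → z * z - 1ℤ) +q≡) (lem i))
    where
    i = + (q ℕ./ 3)
    +q≡ : + q ≡ 1ℤ + i * + 3
    +q≡ = trans (cong +_ e) (cong (λ z → 1ℤ + z) (ℤ.pos-* (q ℕ./ 3) 3))
    lem : ∀ i → (1ℤ + i * + 3) * (1ℤ + i * + 3) - 1ℤ ≡ (+ 3 * i * i + + 2 * i) * + 3
    lem = solve-∀
  ... | 2 | _ | e = ℤ∣.divides (+ 3 * i * i + + 4 * i + 1ℤ) (trans (cong (λ z → z * z - 1ℤ) +q≡) (lem i))
    where
    i = + (q ℕ./ 3)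
    +q≡ : + q ≡ + 2 + i * + 3
    +q≡ = trans (cong +_ e) (cong (λ z → + 2 + z) (ℤ.pos-* (q ℕ./ 3) 3))
    lem : ∀ i → (+ 2 + i * + 3) * (+ 2 + i * + 3) - 1ℤ ≡ (+ 3 * i * i + + 4 * i + 1ℤ) * + 3
    lem = solve-∀
  ... | suc (suc (suc _)) | s≤s (s≤s (s≤s ())) | _

  -- Modulo 3 every term of the formula for a k vanishes: both values of D because 3 ∤ a, and q² - 1
  -- because 3 ∤ q.
  value⇒3∣k : ∀ q k .{{_ : NonZero q}} → Coprime ∣ k ∣ q → Value q k → ¬ (3 ∣ q) → + 3 ℤ∣.∣ k
  value⇒3∣k q k copk v 3∤q with normalise 3 3-prime q k copk v
  ... | a , g , nza , 3∤a , cop , e = prime-∣-cancel 3-prime a k 3∤a (subst (+ 3 ℤ∣.∣_) (sym e)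
    (ℤ∣.∣m∣n⇒∣m-n (ℤ∣.∣m∣n⇒∣m+n (ℤ∣.∣m∣n⇒∣m-n (D-mod-3 g a {{nza}} 3∤a) (ℤ∣.∣n⇒∣m*n (+ q) (D-mod-3 (g ℕ.* q) a {{nza}} 3∤a)))
       (ℤ∣.∣n⇒∣m*n (+ g) (3∤⇒3∣q²-1 q 3∤q)))
     (ℤ∣.∣m⇒∣m*n (+ q - 1ℤ) (ℤ∣.∣m⇒∣m*n (+ a) ℤ∣.∣-refl))))

  2-prime : Prime 2
  2-prime = from-yes (prime? 2)

  -- Both values of D are ≡ a - 1 and q² - 1 ≡ 0, so a k ≡ (q - 1)(1 - 4a) ≡ q - 1 ≡ a (q - 1) (mod
  -- 4), as a and q are odd. One congruence thus covers q ≡ 1 and q ≡ 3.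
  value⇒4∣k-[q-1] : ∀ q k .{{_ : NonZero q}} → Coprime ∣ k ∣ q → Value q k → Odd q → + 4 ℤ∣.∣ k - (+ q - 1ℤ)
  value⇒4∣k-[q-1] q k copk v (j , q≡) with normalise 2 2-prime q k copk v
  ... | a , g , nza , 2∤a , cop , e = conclude (2∤⇒Odd a 2∤a)
    where
    conclude : Odd a → + 4 ℤ∣.∣ k - (+ q - 1ℤ)
    conclude odd@(i , a≡) = odd-cancel-4 a _ odd (combine (+ a) (+ q) (D g a {{nza}}) (D (g ℕ.* q) a {{nza}}) e
      (Odd-+ a i a≡) (Odd-+ q j q≡) (D-mod-4 g a {{nza}} odd) (D-mod-4 (g ℕ.* q) a {{nza}} odd))
      where
      identity : ∀ i j k g x y → (+ 2 * i + 1ℤ) * (k - (+ 2 * j + 1ℤ - 1ℤ)) -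
          ((x - (+ 2 * j + 1ℤ) * y + g * (j * (j + 1ℤ)) - i * j - + 2 * (+ 2 * i + 1ℤ) * j)) * + 4 ≡
        1ℤ * ((+ 2 * i + 1ℤ) * k - ((x * + 4 + (+ 2 * i + 1ℤ - 1ℤ)) - (+ 2 * j + 1ℤ) * (y * + 4 + (+ 2 * i + 1ℤ - 1ℤ))
          + g * ((+ 2 * j + 1ℤ) * (+ 2 * j + 1ℤ) - 1ℤ) - + 3 * (+ 2 * i + 1ℤ) * (+ 2 * j + 1ℤ - 1ℤ)))
      identity = solve-∀
      move : ∀ x y z → x - y ≡ z → x ≡ z + y
      move x y z refl = lem x y
        where
        lem : ∀ x y → x ≡ x - y + y
        lem = solve-∀
      combine : ∀ A Q x y → A * k ≡ x - Q * y + + g * (Q * Q - 1ℤ) - + 3 * A * (Q - 1ℤ) → A ≡ + 2 * + i + 1ℤ → Q ≡ + 2 * + j + 1ℤ →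
        + 4 ℤ∣.∣ x - (A - 1ℤ) → + 4 ℤ∣.∣ y - (A - 1ℤ) → + 4 ℤ∣.∣ A * (k - (Q - 1ℤ))
      combine _ _ x y e refl refl (ℤ∣.divides s s≡) (ℤ∣.divides t t≡) = ℤ∣.divides
        (s - (+ 2 * + j + 1ℤ) * t + + g * (+ j * (+ j + 1ℤ)) - + i * + j - + 2 * (+ 2 * + i + 1ℤ) * + j)
        (linear-combination (identity (+ i) (+ j) k (+ g) s t)
          (1ℤ · trans e (cong₂ (λ x y → x - (+ 2 * + j + 1ℤ) * y + + g * ((+ 2 * + j + 1ℤ) * (+ 2 * + j + 1ℤ) - 1ℤ)
                                   - + 3 * (+ 2 * + i + 1ℤ) * (+ 2 * + j + 1ℤ - 1ℤ))
                         (move x (+ 2 * + i + 1ℤ - 1ℤ) (s * + 4) s≡) (move y (+ 2 * + i + 1ℤ - 1ℤ) (t * + 4) t≡))))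

  odd-square-mod-8 : ∀ m → Odd (m ℕ.* m) → + 8 ℤ∣.∣ + (m ℕ.* m) - 1ℤ
  odd-square-mod-8 m (j , m²≡) = conclude (2∤⇒Odd m 2∤m)
    where
    2∤m : ¬ (2 ∣ m)
    2∤m 2∣m = contradiction (ℕ∣.∣m+n∣m⇒∣n (subst (2 ∣_) m²≡ (ℕ∣.∣m⇒∣m*n m 2∣m)) (ℕ∣.m∣m*n j)) (λ 2∣1 → contradiction (∣⇒≤ 2∣1) λ { (s≤s ()) })
    conclude : Odd m → + 8 ℤ∣.∣ + (m ℕ.* m) - 1ℤ
    conclude (i , m≡) = go (n*[n+1]-even i)
      where
      identity : ∀ m i s → m * m - 1ℤ - s * + 8 ≡ (m + + 2 * i + 1ℤ) * (m - (+ 2 * i + 1ℤ)) + + 4 * (i * (i + 1ℤ) - + 2 * s)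
      identity = solve-∀
      go : (∃[ s ] + i * (+ i + 1ℤ) ≡ + 2 * s) → + 8 ℤ∣.∣ + (m ℕ.* m) - 1ℤ
      go (s , s≡) = ℤ∣.divides s (trans (cong (_- 1ℤ) (ℤ.pos-* m m)) (linear-combination (identity (+ m) (+ i) s)
        ((+ m + + 2 * + i + 1ℤ) · Odd-+ m i m≡ ⊕ + 4 · s≡)))

  -- Modulo 8, q = m² is 1 and `D-mod-8` identifies the two values of D, so all terms of the formula
  -- for a k cancel or vanish.
  value⇒8∣k : ∀ m k .{{_ : NonZero (m ℕ.* m)}} → Coprime ∣ k ∣ (m ℕ.* m) → Value (m ℕ.* m) k → Odd (m ℕ.* m) → + 8 ℤ∣.∣ k
  value⇒8∣k m k copk v oddq with normalise 2 2-prime (m ℕ.* m) k copk v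
  ... | a , g , nza , 2∤a , cop , e = odd-cancel-8 a k odd
    (combine (+ a) (+ (m ℕ.* m)) (D g a {{nza}}) (D (g ℕ.* (m ℕ.* m)) a {{nza}}) e (odd-square-mod-8 m oddq) (D-mod-8 g m a {{nza}} odd cop))
    where
    odd = 2∤⇒Odd a 2∤a
    identity : ∀ A k G Q x y s t → A * k - (- x * s - Q * t + G * (Q + 1ℤ) * s - + 3 * A * s) * + 8 ≡
      1ℤ * (A * k - (x - Q * y + G * (Q * Q - 1ℤ) - + 3 * A * (Q - 1ℤ))) + (- x + G * (Q + 1ℤ) - + 3 * A) * (Q - 1ℤ - s * + 8)
      + - Q * (y - x - t * + 8)
    identity = solve-∀
    combine : ∀ A Q x y → A * k ≡ x - Q * y + + g * (Q * Q - 1ℤ) - + 3 * A * (Q - 1ℤ) →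
      + 8 ℤ∣.∣ Q - 1ℤ → + 8 ℤ∣.∣ y - x → + 8 ℤ∣.∣ A * k
    combine A Q x y e (ℤ∣.divides s s≡) (ℤ∣.divides t t≡) = ℤ∣.divides (- x * s - Q * t + + g * (Q + 1ℤ) * s - + 3 * A * s)
      (linear-combination (identity A k (+ g) Q x y s t) (1ℤ · e ⊕ (- x + + g * (Q + 1ℤ) - + 3 * A) · s≡ ⊕ - Q · t≡))

  -- Words in the matrices R and L.

  -- Word a b c d s: the matrix (a b ; c d) is a product of factors
  -- R = (1 1 ; 0 1) and L = (1 0 ; 1 1), and s is the number of R's minus the number of L's.
  data Word : (a b c d s : ℤ) → Set where
    ε  : Word 1ℤ 0ℤ 0ℤ 1ℤ 0ℤ
    R∷ : ∀ {a b c d s} → Word a b c d s → Word (a + c) (b + d) c d (s + 1ℤ)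
    L∷ : ∀ {a b c d s} → Word a b c d s → Word a b (a + c) (b + d) (s - 1ℤ)

  coerce : ∀ {a b c d s a′ b′ c′ d′ s′} → a ≡ a′ → b ≡ b′ → c ≡ c′ → d ≡ d′ → s ≡ s′ →
    Word a b c d s → Word a′ b′ c′ d′ s′
  coerce refl refl refl refl refl w = w

  _∙_ : ∀ {a b c d s a′ b′ c′ d′ s′} → Word a b c d s → Word a′ b′ c′ d′ s′ →
    Word (a * a′ + b * c′) (a * b′ + b * d′) (c * a′ + d * c′) (c * b′ + d * d′) (s + s′)
  _∙_ {a′ = a′} {b′} {c′} {d′} {s′} ε v = coerce (fst a′ c′) (fst b′ d′) (snd a′ c′) (snd b′ d′) (sym (ℤ.+-identityˡ s′)) v
    where
    fst : ∀ x y → x ≡ 1ℤ * x + 0ℤ * y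
    fst = solve-∀
    snd : ∀ x y → y ≡ 0ℤ * x + 1ℤ * y
    snd = solve-∀
  _∙_ {a′ = a′} {b′} {c′} {d′} {s′} (R∷ {a} {b} {c} {d} {s} w) v =
    coerce (entry a b c d a′ c′) (entry a b c d b′ d′) refl refl (shift s s′) (R∷ (w ∙ v))
    where
    entry : ∀ a b c d x y → (a * x + b * y) + (c * x + d * y) ≡ (a + c) * x + (b + d) * y
    entry = solve-∀
    shift : ∀ s t → s + t + 1ℤ ≡ s + 1ℤ + t
    shift = solve-∀
  _∙_ {a′ = a′} {b′} {c′} {d′} {s′} (L∷ {a} {b} {c} {d} {s} w) v =
    coerce refl refl (entry a b c d a′ c′) (entry a b c d b′ d′) (shift s s′) (L∷ (w ∙ v))
    where
    entry : ∀ a b c d x y → (a * x + b * y) + (c * x + d * y) ≡ (a + c) * x + (b + d) * y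
    entry = solve-∀
    shift : ∀ s t → s + t - 1ℤ ≡ s - 1ℤ + t
    shift = solve-∀

  R^ : ∀ n → Word 1ℤ (+ n) 0ℤ 1ℤ (+ n)
  R^ zero    = ε
  R^ (suc n) = coerce refl (cong +_ (ℕ.+-comm n 1)) refl refl (cong +_ (ℕ.+-comm n 1)) (R∷ (R^ n))

  L^ : ∀ n → Word 1ℤ 0ℤ (+ n) 1ℤ (- + n)
  L^ zero    = ε
  L^ (suc n) = coerce refl refl refl refl (lem (+ n)) (L∷ (L^ n))
    where
    lem : ∀ x → - x - 1ℤ ≡ - (1ℤ + x)
    lem = solve-∀

  det-coprime : ∀ a b c d → a ℕ.* d ≡ 1 ℕ.+ b ℕ.* c → Coprime a c
  det-coprime a b c d e {i} (i∣a , i∣c) = ℕ∣.∣1⇒≡1 (ℕ∣.∣m+n∣m⇒∣n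
    (subst (i ∣_) (trans e (ℕ.+-comm 1 (b ℕ.* c))) (ℕ∣.∣m⇒∣m*n d i∣a)) (ℕ∣.∣n⇒∣m*n b i∣c))

  -- The Dedekind sum of a word.

  -- The induction invariant; `D≡` is S(a, c) = (a + d)/c - 3 - s times c. It is void for c = 0, so
  -- `upper` remembers the weight until an L makes c positive.
  record NatWord (a b c d s : ℤ) : Set where
    field
      a₀ b₀ c₀ d₀ : ℕ
      a≡ : a ≡ + a₀
      b≡ : b ≡ + b₀
      c≡ : c ≡ + c₀
      d≡ : d ≡ + d₀
      det : a₀ ℕ.* d₀ ≡ 1 ℕ.+ b₀ ℕ.* c₀
      upper : c₀ ≡ 0 → s ≡ b
      D≡ : (nz : NonZero c₀) → D a₀ c₀ {{nz}} ≡ a + d - c * (s + + 3)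

  open NatWord

  private
    -- Prepending L turns the column (A, C) into (A, A + C). The unknown y = D(C, A) = D(A + C, A)
    -- is eliminated between the reciprocity laws for (A, A + C) and (A, C).
    step-identity : ∀ A B C d s x y z → A * d ≡ 1ℤ + B * C →
      A * x + (A + C) * y ≡ A * A + (A + C) * (A + C) + 1ℤ - + 3 * A * (A + C) →
      A * z + C * y ≡ A * A + C * C + 1ℤ - + 3 * A * C →
      z ≡ A + d - C * (s + + 3) →
      A * C * x ≡ A * C * (A + (B + d) - (A + C) * (s - 1ℤ + + 3))
    step-identity A B C d s x y z e₀ e₁ e₂ e₃ = linear-combination (identity A B C d s x y z)
      (A · e₀ ⊕ C · e₁ ⊕ - (A + C) · e₂ ⊕ (A + C) * A · e₃)
      where
      identity : ∀ A B C d s x y z →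
        A * C * x - A * C * (A + (B + d) - (A + C) * (s - 1ℤ + + 3)) ≡
        A * (A * d - (1ℤ + B * C))
        + C * (A * x + (A + C) * y - (A * A + (A + C) * (A + C) + 1ℤ - + 3 * A * (A + C)))
        + - (A + C) * (A * z + C * y - (A * A + C * C + 1ℤ - + 3 * A * C))
        + (A + C) * A * (z - (A + d - C * (s + + 3)))
      identity = solve-∀

  det-nonZero : ∀ a b c d → a ℕ.* d ≡ 1 ℕ.+ b ℕ.* c → NonZero a
  det-nonZero (suc _) _ _ _ _ = _

  -- Prepending R adds c to a: D is periodic, and in `D≡` the gain c of the trace is offset by the
  -- gain 1 of the weight. Prepending L is `step-identity`.
  natWord : ∀ {a b c d s} → Word a b c d s → NatWord a b c d s
  natWord ε = record { a₀ = 1; b₀ = 0; c₀ = 0; d₀ = 1; a≡ = refl; b≡ = refl; c≡ = refl; d≡ = refl; det = refl; upper = λ _ → refl; D≡ = λ () }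
  natWord (R∷ {a} {b} {c} {d} {s} w) = record
    { a₀ = a₀ n ℕ.+ c₀ n; b₀ = b₀ n ℕ.+ d₀ n; c₀ = c₀ n; d₀ = d₀ n
    ; a≡ = cong₂ _+_ (a≡ n) (c≡ n); b≡ = cong₂ _+_ (b≡ n) (d≡ n); c≡ = c≡ n; d≡ = d≡ n
    ; det = trans (ℕ.*-distribʳ-+ (d₀ n) (a₀ n) (c₀ n)) (trans (cong (ℕ._+ c₀ n ℕ.* d₀ n) (det n)) (lem (b₀ n) (c₀ n) (d₀ n)))
    ; upper = λ z → cong₂ _+_ (upper n z) (sym (trans (d≡ n) (cong +_ (d₀≡1 z))))
    ; D≡ = λ nz → trans (D-+ (a₀ n) (c₀ n) {{nz}}) (trans (D≡ n nz) (shift a c d s)) }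
    where
    n = natWord w
    lem : ∀ b c d → 1 ℕ.+ b ℕ.* c ℕ.+ c ℕ.* d ≡ 1 ℕ.+ (b ℕ.+ d) ℕ.* c
    lem = ℕ-Solver.solve-∀
    d₀≡1 : c₀ n ≡ 0 → d₀ n ≡ 1
    d₀≡1 z = ℕ.m*n≡1⇒n≡1 (a₀ n) (d₀ n) (trans (det n) (cong suc (trans (cong (b₀ n ℕ.*_) z) (ℕ.*-zeroʳ (b₀ n)))))
    shift : ∀ a c d s → a + d - c * (s + + 3) ≡ a + c + d - c * (s + 1ℤ + + 3)
    shift = solve-∀
  natWord (L∷ {a} {b} {c} {d} {s} w) = record
    { a₀ = a₀ n; b₀ = b₀ n; c₀ = a₀ n ℕ.+ c₀ n; d₀ = b₀ n ℕ.+ d₀ n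
    ; a≡ = a≡ n; b≡ = b≡ n; c≡ = cong₂ _+_ (a≡ n) (c≡ n); d≡ = cong₂ _+_ (b≡ n) (d≡ n)
    ; det = trans (ℕ.*-distribˡ-+ (a₀ n) (b₀ n) (d₀ n)) (trans (cong (a₀ n ℕ.* b₀ n ℕ.+_) (det n)) (lem (a₀ n) (b₀ n) (c₀ n)))
    ; upper = λ z → contradiction (ℕ.m+n≡0⇒m≡0 (a₀ n) z) (ℕ.≢-nonZero⁻¹ (a₀ n) {{nza}})
    ; D≡ = λ nz → D-step (c₀ n) refl nz }
    where
    n = natWord w
    nza : NonZero (a₀ n)
    nza = det-nonZero (a₀ n) (b₀ n) (c₀ n) (d₀ n) (det n)
    lem : ∀ a b c → a ℕ.* b ℕ.+ (1 ℕ.+ b ℕ.* c) ≡ 1 ℕ.+ b ℕ.* (a ℕ.+ c)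
    lem = ℕ-Solver.solve-∀
    +det : a * d ≡ 1ℤ + b * c
    +det = trans (cong₂ _*_ (a≡ n) (d≡ n)) (trans (sym (ℤ.pos-* (a₀ n) (d₀ n))) (trans (cong +_ (det n))
             (cong (λ z → 1ℤ + z) (trans (ℤ.pos-* (b₀ n) (c₀ n)) (sym (cong₂ _*_ (b≡ n) (c≡ n)))))))
    D-step : ∀ m → m ≡ c₀ n → (nz : NonZero (a₀ n ℕ.+ m)) → D (a₀ n) (a₀ n ℕ.+ m) {{nz}} ≡ a + (b + d) - (a + c) * (s - 1ℤ + + 3)
    -- Here c = 0, hence a = d = 1 and s = b; both sides are 0, D(1, 1) by evaluation.
    D-step zero m≡ nz = at-one (a₀ n) (ℕ.m*n≡1⇒m≡1 (a₀ n) (d₀ n) ad≡1) nz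
      where
      ad≡1 : a₀ n ℕ.* d₀ n ≡ 1
      ad≡1 = trans (det n) (cong suc (trans (cong (b₀ n ℕ.*_) (sym m≡)) (ℕ.*-zeroʳ (b₀ n))))
      at-one : ∀ x → x ≡ 1 → (nz : NonZero (x ℕ.+ 0)) → D x (x ℕ.+ 0) {{nz}} ≡ a + (b + d) - (a + c) * (s - 1ℤ + + 3)
      at-one .1 refl nz = sym (vanish a b c d s (trans (a≡ n) (cong +_ (ℕ.m*n≡1⇒m≡1 (a₀ n) (d₀ n) ad≡1)))
        (trans (c≡ n) (cong +_ (sym m≡))) (trans (d≡ n) (cong +_ (ℕ.m*n≡1⇒n≡1 (a₀ n) (d₀ n) ad≡1))) (upper n (sym m≡)))
        where
        vanish : ∀ a b c d s → a ≡ 1ℤ → c ≡ 0ℤ → d ≡ 1ℤ → s ≡ b → a + (b + d) - (a + c) * (s - 1ℤ + + 3) ≡ 0ℤ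
        vanish _ b _ _ _ refl refl refl refl = zero-identity b
          where
          zero-identity : ∀ b → 1ℤ + (b + 1ℤ) - (1ℤ + 0ℤ) * (b - 1ℤ + + 3) ≡ 0ℤ
          zero-identity = solve-∀
    D-step (suc m) m≡ nz = cancel (+ a₀ n * + suc m) {{ℤ.i*j≢0 (+ a₀ n) (+ suc m) {{nza}}}} _ _
      (subst₂ (λ A C → A * C * D (a₀ n) (a₀ n ℕ.+ suc m) {{nz}} ≡ A * C * (a + (b + d) - (a + c) * (s - 1ℤ + + 3))) (a≡ n) c≡′
        (step-identity a b c d s _ (D (suc m) (a₀ n) {{nza}}) (D (a₀ n) (suc m)) +det
          (subst₂ (λ A C → A * D (a₀ n) (a₀ n ℕ.+ suc m) {{nz}} + (A + C) * D (suc m) (a₀ n) {{nza}} ≡ A * A + (A + C) * (A + C) + 1ℤ - + 3 * A * (A + C)) (sym (a≡ n)) (sym c≡′)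
            (trans (cong (λ z → + a₀ n * D (a₀ n) (a₀ n ℕ.+ suc m) {{nz}} + + (a₀ n ℕ.+ suc m) * z)
                     (sym (trans (cong (λ i → D i (a₀ n) {{nza}}) (ℕ.+-comm (a₀ n) (suc m))) (D-+ (suc m) (a₀ n) {{nza}}))))
              (D-reciprocity (a₀ n) (a₀ n ℕ.+ suc m) {{nza}} {{nz}} cop′)))
          (subst₂ (λ A C → A * D (a₀ n) (suc m) + C * D (suc m) (a₀ n) {{nza}} ≡ A * A + C * C + 1ℤ - + 3 * A * C) (sym (a≡ n)) (sym c≡′)
            (D-reciprocity (a₀ n) (suc m) {{nza}} cop))
          (D≡-at (c₀ n) m≡ (D≡ n))))
      where
      cancel : ∀ i .{{_ : ℤ.NonZero i}} j k → i * j ≡ i * k → j ≡ k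
      cancel i j k = ℤ.*-cancelˡ-≡ i j k
      c≡′ : c ≡ + suc m
      c≡′ = trans (c≡ n) (cong +_ (sym m≡))
      cop : Coprime (a₀ n) (suc m)
      cop = subst (Coprime (a₀ n)) (sym m≡) (det-coprime (a₀ n) (b₀ n) (c₀ n) (d₀ n) (det n))
      cop′ : Coprime (a₀ n) (a₀ n ℕ.+ suc m)
      cop′ (i∣a , i∣a+c) = cop (i∣a , ℕ∣.∣m+n∣m⇒∣n i∣a+c i∣a)
      D≡-at : ∀ c₁ → suc m ≡ c₁ → ((nz : NonZero c₁) → D (a₀ n) c₁ {{nz}} ≡ a + d - c * (s + + 3)) → D (a₀ n) (suc m) ≡ a + d - c * (s + + 3)
      D≡-at _ refl h = h _

  -- Euclid's algorithm on the first column. The determinant forces b ≤ d when a ≤ c, and d ≤ b when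
  -- c < a, so the smaller row can be subtracted from the larger; c = 0 leaves a power of R. `fuel`
  -- bounds a + c.
  word : ∀ a b c d → a ℕ.* d ≡ 1 ℕ.+ b ℕ.* c → ∃[ s ] Word (+ a) (+ b) (+ c) (+ d) s
  word a b c d det = go (a ℕ.+ c) a b c d ℕ.≤-refl det
    where
    go : ∀ fuel a b c d → a ℕ.+ c ≤ fuel → a ℕ.* d ≡ 1 ℕ.+ b ℕ.* c → ∃[ s ] Word (+ a) (+ b) (+ c) (+ d) s
    go fuel a b zero d _ det = + b , upper-case a d
        (ℕ.m*n≡1⇒m≡1 a d (trans det (cong suc (ℕ.*-zeroʳ b)))) (ℕ.m*n≡1⇒n≡1 a d (trans det (cong suc (ℕ.*-zeroʳ b))))
      where
      upper-case : ∀ a d → a ≡ 1 → d ≡ 1 → Word (+ a) (+ b) 0ℤ (+ d) (+ b)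
      upper-case _ _ refl refl = R^ b
    go (suc fuel) (suc a) b (suc c) d (s≤s fuel≥) det with suc a ℕ.≤? suc c
    ... | yes a≤c = strip-L (ℕ.m≤n⇒∃[o]m+o≡n a≤c) (ℕ.m≤n⇒∃[o]m+o≡n b≤d)
      where
      b≤d : b ≤ d
      b≤d = ℕ.*-cancelˡ-≤ (suc a) (begin
        suc a ℕ.* b         ≡⟨ ℕ.*-comm (suc a) b ⟩
        b ℕ.* suc a         ≤⟨ ℕ.*-monoʳ-≤ b a≤c ⟩
        b ℕ.* suc c         ≤⟨ ℕ.n≤1+n _ ⟩
        1 ℕ.+ b ℕ.* suc c   ≡⟨ sym det ⟩
        suc a ℕ.* d         ∎)
        where open ℕ.≤-Reasoning
      strip-L : (∃[ c′ ] suc a ℕ.+ c′ ≡ suc c) → (∃[ d′ ] b ℕ.+ d′ ≡ d) → ∃[ s ] Word (+ suc a) (+ b) (+ suc c) (+ d) s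
      strip-L (c′ , refl) (d′ , refl) with go fuel (suc a) b c′ d′ (ℕ.≤-trans (ℕ.m≤n+m (suc (a ℕ.+ c′)) a) fuel≥) det′
        where
        lem₁ : ∀ a b d → suc a ℕ.* (b ℕ.+ d) ≡ suc a ℕ.* d ℕ.+ b ℕ.* suc a
        lem₁ = ℕ-Solver.solve-∀
        lem₂ : ∀ a b c → 1 ℕ.+ b ℕ.* (suc a ℕ.+ c) ≡ 1 ℕ.+ b ℕ.* c ℕ.+ b ℕ.* suc a
        lem₂ = ℕ-Solver.solve-∀
        det′ : suc a ℕ.* d′ ≡ 1 ℕ.+ b ℕ.* c′
        det′ = ℕ.+-cancelʳ-≡ (b ℕ.* suc a) _ _ (trans (sym (lem₁ a b d′)) (trans det (lem₂ a b c′)))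
      ... | s , w = s - 1ℤ , L∷ w
    ... | no a≰c = strip-R (ℕ.m≤n⇒∃[o]m+o≡n (ℕ.<⇒≤ c<a)) (ℕ.m≤n⇒∃[o]m+o≡n (ℕ.≮⇒≥ b≮d))
      where
      c<a : suc c < suc a
      c<a = ℕ.≰⇒> a≰c
      b≮d : ¬ (b < d)
      b≮d b<d = ℕ.<-irrefl (sym det) (begin-strict
        1 ℕ.+ b ℕ.* suc c                     <⟨ s≤s (ℕ.m<m+n (b ℕ.* suc c) {suc c ℕ.+ b} (s≤s z≤n)) ⟩
        1 ℕ.+ (b ℕ.* suc c ℕ.+ (suc c ℕ.+ b)) ≡⟨ lem b c ⟩
        suc (suc c) ℕ.* suc b                 ≤⟨ ℕ.*-mono-≤ c<a b<d ⟩
        suc a ℕ.* d                           ∎)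
        where
        open ℕ.≤-Reasoning
        lem : ∀ b c → 1 ℕ.+ (b ℕ.* suc c ℕ.+ (suc c ℕ.+ b)) ≡ suc (suc c) ℕ.* suc b
        lem = ℕ-Solver.solve-∀
      strip-R : (∃[ a′ ] suc c ℕ.+ a′ ≡ suc a) → (∃[ b′ ] d ℕ.+ b′ ≡ b) → ∃[ s ] Word (+ suc a) (+ b) (+ suc c) (+ d) s
      strip-R (a′ , refl) (b′ , refl) with go fuel a′ b′ (suc c) d (ℕ.≤-trans (ℕ.+-monoˡ-≤ (suc c) (ℕ.m≤n+m a′ c)) fuel≥) det′
        where
        lem₁ : ∀ a c d → (suc c ℕ.+ a) ℕ.* d ≡ a ℕ.* d ℕ.+ d ℕ.* suc c
        lem₁ = ℕ-Solver.solve-∀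
        lem₂ : ∀ b c d → 1 ℕ.+ (d ℕ.+ b) ℕ.* suc c ≡ 1 ℕ.+ b ℕ.* suc c ℕ.+ d ℕ.* suc c
        lem₂ = ℕ-Solver.solve-∀
        det′ : a′ ℕ.* d ≡ 1 ℕ.+ b′ ℕ.* suc c
        det′ = ℕ.+-cancelʳ-≡ (d ℕ.* suc c) _ _ (trans (sym (lem₁ a′ c d)) (trans det (lem₂ b′ c d)))
      ... | s , w = s + 1ℤ , coerce (cong +_ (ℕ.+-comm a′ (suc c))) (cong +_ (ℕ.+-comm b′ d)) refl refl refl (R∷ w)

  -- Values from products U B Z.

  -- `commutes` equates the lower left entries of W times its power and of the power times W. It is
  -- what puts the upper right entry of the next power into the form q²e′.
  record SymmetricPower (q f e h p : ℤ) (j : ℕ) : Set where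
    field
      f′ e′ h′ : ℤ
      commutes : e * f′ + h * e′ ≡ f * e′ + e * h′
      power : Word f′ (q * q * e′) e′ h′ (+ j * p)

  -- The powers of W all have the form (f′ q²e′ ; e′ h′), because W is conjugate
  -- to the symmetric matrix (f qe ; qe h).
  symmetricPower : ∀ q {f e h p} → Word f (q * q * e) e h p → ∀ j → SymmetricPower q f e h p j
  symmetricPower q {f} {e} {h} {p} w zero = record
    { f′ = 1ℤ ; e′ = 0ℤ ; h′ = 1ℤ ; commutes = lem₁ e f h
    ; power = coerce refl (lem₂ q) refl refl refl ε }
    where
    lem₁ : ∀ e f h → e * 1ℤ + h * 0ℤ ≡ f * 0ℤ + e * 1ℤ
    lem₁ = solve-∀
    lem₂ : ∀ q → 0ℤ ≡ q * q * 0ℤ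
    lem₂ = solve-∀
  symmetricPower q {f} {e} {h} {p} w (suc j) = record
    { f′ = f * f′ + q * q * e * e′ ; e′ = e * f′ + h * e′ ; h′ = e * (q * q * e′) + h * h′
    ; commutes = linear-combination (lem₁ q f e h f′ e′ h′) (h · commutes)
    ; power = coerce refl (linear-combination (lem₂ q f e h f′ e′ h′) (- (q * q) · commutes)) refl refl (lem₃ p (+ j)) (w ∙ power) }
    where
    open SymmetricPower (symmetricPower q w j)
    lem₁ : ∀ q f e h f′ e′ h′ → e * (f * f′ + q * q * e * e′) + h * (e * f′ + h * e′)
      - (f * (e * f′ + h * e′) + e * (e * (q * q * e′) + h * h′)) ≡ h * (e * f′ + h * e′ - (f * e′ + e * h′))
    lem₁ = solve-∀
    lem₂ : ∀ q f e h f′ e′ h′ → f * (q * q * e′) + q * q * e * h′ - q * q * (e * f′ + h * e′) ≡ - (q * q) * (e * f′ + h * e′ - (f * e′ + e * h′))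
    lem₂ = solve-∀
    lem₃ : ∀ p j → p + j * p ≡ (1ℤ + j) * p
    lem₃ = solve-∀

  private
    -- diag(1, q²) B is symmetric, so q (x, qy) B (z₁, z₂)ᵗ = (z₁, q² z₂) B (qx, y)ᵗ. Hence q times
    -- the trace of U B Z is (q u₁ + z₁, q (u₂ + q z₂)) B (qx, y)ᵗ, and the hypotheses make the row
    -- K (x, qy).
    trace-identity : ∀ q x y u₁ u₂ z₁ z₂ f e h K → q * u₁ + z₁ ≡ x * K → u₂ + q * z₂ ≡ y * K →
      q * (((u₁ * f + u₂ * e) * (q * x) + (u₁ * (q * q * e) + u₂ * h) * y)
         + ((x * f + q * y * e) * z₁ + (x * (q * q * e) + q * y * h) * z₂))
      ≡ K * ((x * f + q * y * e) * (q * x) + (x * (q * q * e) + q * y * h) * y)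
    trace-identity q x y u₁ u₂ z₁ z₂ f e h K e₁ e₂ = linear-combination (identity q x y u₁ u₂ z₁ z₂ f e h K)
      (q * (f * x + e * q * y) · e₁ ⊕ q * (h * y + e * q * x) · e₂)
      where
      identity : ∀ q x y u₁ u₂ z₁ z₂ f e h K →
        q * (((u₁ * f + u₂ * e) * (q * x) + (u₁ * (q * q * e) + u₂ * h) * y)
           + ((x * f + q * y * e) * z₁ + (x * (q * q * e) + q * y * h) * z₂))
        - K * ((x * f + q * y * e) * (q * x) + (x * (q * q * e) + q * y * h) * y)
        ≡ q * (f * x + e * q * y) * (q * u₁ + z₁ - x * K) + q * (h * y + e * q * x) * (u₂ + q * z₂ - y * K)
      identity = solve-∀

  word-value : ∀ q .{{_ : NonZero q}} K {a b c d s} → Word a b c d s → + q * (a + d) ≡ K * c →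
    Value q (K - + q * (s + + 3))
  word-value q@(suc _) K {a} {b} {c} {d} {s} w tr = from (c₀ n) refl
    where
    n = natWord w
    from : ∀ c₁ → c₁ ≡ c₀ n → Value q (K - + q * (s + + 3))
    -- c = 0 would make the trace 0, whereas then a = d = 1.
    from zero c₁≡ = contradiction (trans (ℤ.*-cancelˡ-≡ (+ q) _ _ (trans tr (trans (cong (K *_) (trans (c≡ n) (cong +_ (sym c₁≡))))
        (trans (ℤ.*-zeroʳ K) (sym (ℤ.*-zeroʳ (+ q))))))) refl) a+d≢0
      where
      ad≡1 : a₀ n ℕ.* d₀ n ≡ 1
      ad≡1 = trans (det n) (cong suc (trans (cong (b₀ n ℕ.*_) (sym c₁≡)) (ℕ.*-zeroʳ (b₀ n))))
      a+d≢0 : ¬ (a + d ≡ 0ℤ)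
      a+d≢0 z with trans (sym (cong₂ _+_ (trans (a≡ n) (cong +_ (ℕ.m*n≡1⇒m≡1 (a₀ n) (d₀ n) ad≡1)))
                                         (trans (d≡ n) (cong +_ (ℕ.m*n≡1⇒n≡1 (a₀ n) (d₀ n) ad≡1))))) z
      ... | ()
    from (suc c₁) c₁≡ = a₀ n , c₀ n , nz , det-coprime (a₀ n) (b₀ n) (c₀ n) (d₀ n) (det n) ,
        trans (combine (+ q) a d c s (D≡ n nz) tr) (cong ((K - + q * (s + + 3)) *_) (c≡ n))
      where
      nz : NonZero (c₀ n)
      nz = subst NonZero c₁≡ _
      combine : ∀ q a d c s {x} → x ≡ a + d - c * (s + + 3) → q * (a + d) ≡ K * c → x * q ≡ (K - q * (s + + 3)) * c
      combine q a d c s refl e = linear-combination (identity q a d c s K) (1ℤ · e)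
        where
        identity : ∀ q a d c s K → (a + d - c * (s + + 3)) * q - (K - q * (s + + 3)) * c ≡ 1ℤ * (q * (a + d) - K * c)
        identity = solve-∀

  sandwich-value : ∀ q .{{_ : NonZero q}} x y u₁ u₂ z₁ z₂ f e h K {s t r} →
    Word u₁ u₂ x (+ q * y) s → Word f (+ q * + q * e) e h t → Word (+ q * x) z₁ y z₂ r →
    + q * u₁ + z₁ ≡ x * K → u₂ + + q * z₂ ≡ y * K → Value q (K - + q * (s + t + r + + 3))
  sandwich-value q x y u₁ u₂ z₁ z₂ f e h K U B Z e₁ e₂ =
    word-value q K ((U ∙ B) ∙ Z) (trace-identity (+ q) x y u₁ u₂ z₁ z₂ f e h K e₁ e₂)

  -- A two-parameter family of values in each residue class.

  -- The product L R^E L^N R.  Its second row is (x, qy′) with (x, y′) = (1, y) + n q (E + 1) (q, 1),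
  -- the image of (1, y) under a parabolic matrix fixing (q, 1).
  left-word : ∀ q y E n N → + q * y ≡ E + + 2 → ∀ {E₀ N₀} → E ≡ + E₀ → N ≡ + N₀ → N ≡ n * (+ q * + q) →
    Word (1ℤ + E * N) (1ℤ + E + E * N) (1ℤ + (E + 1ℤ) * N) (+ q * (y + n * + q * (E + 1ℤ))) (E - N)
  left-word q y E n N H₁ {E₀} {N₀} refl refl HN = coerce (entry-a E N) (entry-b E N) (entry-c E N)
    (linear-combination (entry-d (+ q) y E n N) (- 1ℤ · H₁ ⊕ (E + 1ℤ) · HN)) (weight E N)
    (((L^ 1 ∙ R^ E₀) ∙ L^ N₀) ∙ R^ 1)
    where
    entry-a : ∀ E N → ((1ℤ * 1ℤ + 0ℤ * 0ℤ) * 1ℤ + (1ℤ * E + 0ℤ * 1ℤ) * N) * 1ℤ + ((1ℤ * 1ℤ + 0ℤ * 0ℤ) * 0ℤ + (1ℤ * E + 0ℤ * 1ℤ) * 1ℤ) * 0ℤ ≡ 1ℤ + E * N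
    entry-a = solve-∀
    entry-b : ∀ E N → ((1ℤ * 1ℤ + 0ℤ * 0ℤ) * 1ℤ + (1ℤ * E + 0ℤ * 1ℤ) * N) * 1ℤ + ((1ℤ * 1ℤ + 0ℤ * 0ℤ) * 0ℤ + (1ℤ * E + 0ℤ * 1ℤ) * 1ℤ) * 1ℤ ≡ 1ℤ + E + E * N
    entry-b = solve-∀
    entry-c : ∀ E N → ((1ℤ * 1ℤ + 1ℤ * 0ℤ) * 1ℤ + (1ℤ * E + 1ℤ * 1ℤ) * N) * 1ℤ + ((1ℤ * 1ℤ + 1ℤ * 0ℤ) * 0ℤ + (1ℤ * E + 1ℤ * 1ℤ) * 1ℤ) * 0ℤ ≡ 1ℤ + (E + 1ℤ) * N
    entry-c = solve-∀
    entry-d : ∀ q y E n N → ((1ℤ * 1ℤ + 1ℤ * 0ℤ) * 1ℤ + (1ℤ * E + 1ℤ * 1ℤ) * N) * 1ℤ + ((1ℤ * 1ℤ + 1ℤ * 0ℤ) * 0ℤ + (1ℤ * E + 1ℤ * 1ℤ) * 1ℤ) * 1ℤ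
      - q * (y + n * q * (E + 1ℤ)) ≡ - 1ℤ * (q * y - (E + + 2)) + (E + 1ℤ) * (N - n * (q * q))
    entry-d = solve-∀
    weight : ∀ E N → - 1ℤ + E + - N + 1ℤ ≡ E - N
    weight = solve-∀

  -- The product R^(q²-1) L R^n Z, with first column (qx, y′) for the same (x, y′).
  right-word : ∀ q y E z w N n Q₁ {r} → + q * y ≡ E + + 2 → + q * + q ≡ + Q₁ + 1ℤ → N ≡ (1ℤ + + n) * (+ q * + q) →
    Word y z (+ q * (E + 1ℤ)) w r →
    Word (+ q * (1ℤ + (E + 1ℤ) * N)) (z + + n * w + + Q₁ * (z + (1ℤ + + n) * w)) (y + (1ℤ + + n) * + q * (E + 1ℤ)) (z + (1ℤ + + n) * w) (+ Q₁ - 1ℤ + + n + r)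
  right-word q y E z w N n Q₁ {r} H₁ H₂ HN Z = coerce
    (linear-combination (entry-a (+ q) y E (+ n) N (+ Q₁))
      (+ q · H₁ ⊕ - (y + (1ℤ + + n) * + q * (E + 1ℤ)) · H₂ ⊕ - (+ q * (E + 1ℤ)) · HN))
    (entry-b (+ n) (+ Q₁) z w) (entry-c (+ n) y (+ q * (E + 1ℤ)) (+ q) (E + 1ℤ) refl) (entry-d (+ n) z w) refl
    (((R^ Q₁ ∙ L^ 1) ∙ R^ n) ∙ Z)
    where
    entry-a : ∀ q y E n N Q → ((1ℤ * 1ℤ + Q * 1ℤ) * 1ℤ + (1ℤ * 0ℤ + Q * 1ℤ) * 0ℤ) * y + ((1ℤ * 1ℤ + Q * 1ℤ) * n + (1ℤ * 0ℤ + Q * 1ℤ) * 1ℤ) * (q * (E + 1ℤ))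
      - q * (1ℤ + (E + 1ℤ) * N) ≡ q * (q * y - (E + + 2)) + - (y + (1ℤ + n) * q * (E + 1ℤ)) * (q * q - (Q + 1ℤ)) + - (q * (E + 1ℤ)) * (N - (1ℤ + n) * (q * q))
    entry-a = solve-∀
    entry-b : ∀ n Q z w → ((1ℤ * 1ℤ + Q * 1ℤ) * 1ℤ + (1ℤ * 0ℤ + Q * 1ℤ) * 0ℤ) * z + ((1ℤ * 1ℤ + Q * 1ℤ) * n + (1ℤ * 0ℤ + Q * 1ℤ) * 1ℤ) * w
      ≡ z + n * w + Q * (z + (1ℤ + n) * w)
    entry-b = solve-∀
    entry-c : ∀ n y v q D → v ≡ q * D → ((0ℤ * 1ℤ + 1ℤ * 1ℤ) * 1ℤ + (0ℤ * 0ℤ + 1ℤ * 1ℤ) * 0ℤ) * y + ((0ℤ * 1ℤ + 1ℤ * 1ℤ) * n + (0ℤ * 0ℤ + 1ℤ * 1ℤ) * 1ℤ) * v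
      ≡ y + (1ℤ + n) * q * D
    entry-c n y _ q D refl = lem n y q D
      where
      lem : ∀ n y q D → ((0ℤ * 1ℤ + 1ℤ * 1ℤ) * 1ℤ + (0ℤ * 0ℤ + 1ℤ * 1ℤ) * 0ℤ) * y + ((0ℤ * 1ℤ + 1ℤ * 1ℤ) * n + (0ℤ * 0ℤ + 1ℤ * 1ℤ) * 1ℤ) * (q * D)
        ≡ y + (1ℤ + n) * q * D
      lem = solve-∀
    entry-d : ∀ n z w → ((0ℤ * 1ℤ + 1ℤ * 1ℤ) * 1ℤ + (0ℤ * 0ℤ + 1ℤ * 1ℤ) * 0ℤ) * z + ((0ℤ * 1ℤ + 1ℤ * 1ℤ) * n + (0ℤ * 0ℤ + 1ℤ * 1ℤ) * 1ℤ) * w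
      ≡ z + (1ℤ + n) * w
    entry-d = solve-∀

  -- The choice y ≡ -1/κ (mod q) yields K = q + κ. The left word has weight E - N with N = (n + 1)
  -- q², the right word q² - 2 + n + r, so raising n by 1 adds q (q² - 1) to k; raising the exponent
  -- j of `W` by 1 subtracts q p.
  value-family : ∀ q y E κ z Q₁ .{{_ : NonZero q}} → q ℕ.* y ≡ E ℕ.+ 2 → κ ℕ.* y ℕ.+ 1 ≡ q ℕ.* z → q ℕ.* q ≡ Q₁ ℕ.+ 1 →
    ∀ {f e h p} → Word f (+ q * + q * e) e h p →
    ∃[ C ] ∀ n j → Value q (+ κ + + q * (C + + n * + Q₁ - + j * p))
  value-family q y E κ z Q₁ h₁ h₂ h₃ {f} {e} {h} {p} W = - + E - r , λ n j → member n j
    where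
    det-Z : y ℕ.* (q ℕ.+ (E ℕ.+ 1) ℕ.* κ) ≡ 1 ℕ.+ z ℕ.* (q ℕ.* (E ℕ.+ 1))
    det-Z = begin
      y ℕ.* (q ℕ.+ (E ℕ.+ 1) ℕ.* κ)         ≡⟨ lem₁ y q E κ ⟩
      q ℕ.* y ℕ.+ (E ℕ.+ 1) ℕ.* (κ ℕ.* y)   ≡⟨ cong (ℕ._+ (E ℕ.+ 1) ℕ.* (κ ℕ.* y)) h₁ ⟩
      E ℕ.+ 2 ℕ.+ (E ℕ.+ 1) ℕ.* (κ ℕ.* y)   ≡⟨ lem₂ E (κ ℕ.* y) ⟩
      1 ℕ.+ (E ℕ.+ 1) ℕ.* (κ ℕ.* y ℕ.+ 1)   ≡⟨ cong (λ t → 1 ℕ.+ (E ℕ.+ 1) ℕ.* t) h₂ ⟩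
      1 ℕ.+ (E ℕ.+ 1) ℕ.* (q ℕ.* z)         ≡⟨ lem₃ E q z ⟩
      1 ℕ.+ z ℕ.* (q ℕ.* (E ℕ.+ 1))         ∎
      where
      open ≡-Reasoning
      lem₁ : ∀ y q E κ → y ℕ.* (q ℕ.+ (E ℕ.+ 1) ℕ.* κ) ≡ q ℕ.* y ℕ.+ (E ℕ.+ 1) ℕ.* (κ ℕ.* y)
      lem₁ = ℕ-Solver.solve-∀
      lem₂ : ∀ E t → E ℕ.+ 2 ℕ.+ (E ℕ.+ 1) ℕ.* t ≡ 1 ℕ.+ (E ℕ.+ 1) ℕ.* (t ℕ.+ 1)
      lem₂ = ℕ-Solver.solve-∀
      lem₃ : ∀ E q z → 1 ℕ.+ (E ℕ.+ 1) ℕ.* (q ℕ.* z) ≡ 1 ℕ.+ z ℕ.* (q ℕ.* (E ℕ.+ 1))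
      lem₃ = ℕ-Solver.solve-∀
    -- Completes the column (y, q (E + 1)) to determinant 1. Its weight r enters only the constant
    -- C.
    Z = word y z (q ℕ.* (E ℕ.+ 1)) (q ℕ.+ (E ℕ.+ 1) ℕ.* κ) det-Z
    r = proj₁ Z
    H₁ : + q * + y ≡ + E + + 2
    H₁ = trans (sym (ℤ.pos-* q y)) (cong +_ h₁)
    H₂ : + κ * + y + 1ℤ ≡ + q * + z
    H₂ = trans (cong (_+ 1ℤ) (sym (ℤ.pos-* κ y))) (trans (cong +_ h₂) (ℤ.pos-* q z))
    H₃ : + q * + q ≡ + Q₁ + 1ℤ
    H₃ = trans (sym (ℤ.pos-* q q)) (cong +_ h₃)
    w = + q + (+ E + 1ℤ) * + κ
    x-identity : ∀ q y E κ z Q N n → q * (1ℤ + E * N) + (z + n * (q + (E + 1ℤ) * κ) + Q * (z + (1ℤ + n) * (q + (E + 1ℤ) * κ)))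
      - (1ℤ + (E + 1ℤ) * N) * (q + κ) ≡ κ * (q * y - (E + + 2)) + - q * (κ * y + 1ℤ - q * z)
      + - (z + (1ℤ + n) * (q + (E + 1ℤ) * κ)) * (q * q - (Q + 1ℤ)) + - (q + κ * (E + 1ℤ)) * (N - (1ℤ + n) * (q * q))
    x-identity = solve-∀
    y-identity : ∀ q y E κ z N n → 1ℤ + E + E * N + q * (z + (1ℤ + n) * (q + (E + 1ℤ) * κ))
      - (y + (1ℤ + n) * q * (E + 1ℤ)) * (q + κ) ≡ - 1ℤ * (q * y - (E + + 2)) + - 1ℤ * (κ * y + 1ℤ - q * z) + E * (N - (1ℤ + n) * (q * q))
    y-identity = solve-∀
    k-identity : ∀ q κ E N Q n r t → q + κ - q * (E - N + t + (Q - 1ℤ + n + r) + + 3) - (κ + q * (- E - r + n * Q - t)) ≡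
      q * (N - (1ℤ + n) * (q * q)) + q * (1ℤ + n) * (q * q - (Q + 1ℤ))
    k-identity = solve-∀
    member : ∀ n j → Value q (+ κ + + q * (- + E - r + + n * + Q₁ - + j * p))
    member n j = subst (Value q) k≡
      (sandwich-value q (1ℤ + (+ E + 1ℤ) * N) (+ y + (1ℤ + + n) * + q * (+ E + 1ℤ)) (1ℤ + + E * N) (1ℤ + + E + + E * N)
        (+ z + + n * w + + Q₁ * (+ z + (1ℤ + + n) * w)) (+ z + (1ℤ + + n) * w)
        f′ e′ h′ (+ q + + κ)
        (left-word q (+ y) (+ E) (1ℤ + + n) N H₁ refl refl HN)
        power
        (right-word q (+ y) (+ E) (+ z) w N n Q₁ H₁ H₃ HN
          (coerce refl refl (ℤ.pos-* q (E ℕ.+ 1)) (cong (λ t → + q + t) (ℤ.pos-* (E ℕ.+ 1) κ)) refl (proj₂ Z)))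
        (linear-combination (x-identity (+ q) (+ y) (+ E) (+ κ) (+ z) (+ Q₁) N (+ n))
          (+ κ · H₁ ⊕ - + q · H₂ ⊕ - (+ z + (1ℤ + + n) * w) · H₃ ⊕ - (+ q + + κ * (+ E + 1ℤ)) · HN))
        (linear-combination (y-identity (+ q) (+ y) (+ E) (+ κ) (+ z) N (+ n))
          (- 1ℤ · H₁ ⊕ - 1ℤ · H₂ ⊕ + E · HN)))
      where
      N = + (suc n ℕ.* (q ℕ.* q))
      HN : N ≡ (1ℤ + + n) * (+ q * + q)
      HN = trans (ℤ.pos-* (suc n) (q ℕ.* q)) (cong ((1ℤ + + n) *_) (ℤ.pos-* q q))
      k≡ : + q + + κ - + q * (+ E - N + + j * p + (+ Q₁ - 1ℤ + + n + r) + + 3) ≡ + κ + + q * (- + E - r + + n * + Q₁ - + j * p)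
      k≡ = linear-combination (k-identity (+ q) (+ κ) (+ E) N (+ Q₁) (+ n) r (+ j * p)) (+ q · HN ⊕ + q * (1ℤ + + n) · H₃)
      open SymmetricPower (symmetricPower (+ q) W j)

  -- Generating words for each q up to 60.

  -- The entries and the weight are fields inferred from `factors`, so a list of exponents yields
  -- them by evaluation.
  record Element : Set where
    constructor element
    field
      {a b c d s} : ℤ
      factors     : Word a b c d s

  fromR fromL : List ℕ → Element
  fromR []       = element ε
  fromR (n ∷ ns) = element (R^ n ∙ Element.factors (fromL ns))
  fromL []       = element ε
  fromL (n ∷ ns) = element (L^ n ∙ Element.factors (fromR ns))

  IsSquare : ℕ → Set
  IsSquare q = ∃[ m ] m ℕ.* m ≡ q

  isSquare? : ∀ q → Dec (IsSquare q)
  isSquare? q with ℕ.anyUpTo? (λ m → m ℕ.* m ℕ.≟ q) (suc q)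
  ... | yes (m , _ , e) = yes (m , e)
  ... | no none = no λ (m , e) → none (m , s≤s (m≤q m e) , e)
    where
    m≤q : ∀ m → m ℕ.* m ≡ q → m ≤ q
    m≤q zero    _ = z≤n
    m≤q (suc m) e = subst (suc m ≤_) e (ℕ.m≤m*n (suc m) (suc m))

  -- The divisor that the necessary conditions force on (k - k′)/q for admissible k ≡ k′ (mod q);
  -- see `modulus-∣`.
  modulus₃ modulus₂ modulus : ℕ → ℕ
  modulus₃ q with 3 ∣? q
  ... | yes _ = 1
  ... | no  _ = 3
  modulus₂ q with 2 ∣? q | isSquare? q
  ... | yes _ | _     = 1
  ... | no  _ | yes _ = 8
  ... | no  _ | no  _ = 4
  modulus q = modulus₃ q ℕ.* modulus₂ q

  -- For q = 2, 3, …, 60: exponents of a word W = R^n₁ L^n₂ R^n₃ ⋯ = (f q²e ; e h) whose weight p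
  -- satisfies gcd(p, q² - 1) = modulus q, found by factoring q²e² + 1 = fh for small e.
  table : List (List ℕ)
  table =
    (4 ∷ 1 ∷ []) ∷ (1 ∷ 1 ∷ 4 ∷ []) ∷ (2 ∷ 2 ∷ 6 ∷ []) ∷ (1 ∷ 1 ∷ 12 ∷ []) ∷ (4 ∷ 3 ∷ 8 ∷ []) ∷
    (4 ∷ 1 ∷ 9 ∷ []) ∷ (4 ∷ 1 ∷ 12 ∷ []) ∷ (3 ∷ 3 ∷ 24 ∷ []) ∷ (8 ∷ 5 ∷ 12 ∷ []) ∷ (3 ∷ 3 ∷ 36 ∷ []) ∷
    (4 ∷ 1 ∷ 28 ∷ []) ∷ (4 ∷ 1 ∷ 33 ∷ []) ∷ (12 ∷ 7 ∷ 16 ∷ []) ∷ (3 ∷ 4 ∷ 69 ∷ []) ∷ (2 ∷ 6 ∷ 118 ∷ []) ∷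
    (4 ∷ 1 ∷ 57 ∷ []) ∷ (4 ∷ 1 ∷ 64 ∷ []) ∷ (4 ∷ 3 ∷ 83 ∷ []) ∷ (4 ∷ 3 ∷ 92 ∷ []) ∷ (5 ∷ 1 ∷ 7 ∷ 1 ∷ 74 ∷ []) ∷
    (4 ∷ 1 ∷ 96 ∷ []) ∷ (4 ∷ 1 ∷ 105 ∷ []) ∷ (3 ∷ 4 ∷ 177 ∷ []) ∷ (5 ∷ 5 ∷ 120 ∷ []) ∷ (7 ∷ 4 ∷ 93 ∷ []) ∷
    (4 ∷ 1 ∷ 145 ∷ []) ∷ (4 ∷ 1 ∷ 156 ∷ []) ∷ (3 ∷ 1 ∷ 2 ∷ 2 ∷ 226 ∷ []) ∷ (16 ∷ 1 ∷ 52 ∷ []) ∷ (12 ∷ 1 ∷ 73 ∷ []) ∷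
    (4 ∷ 1 ∷ 204 ∷ []) ∷ (4 ∷ 1 ∷ 217 ∷ []) ∷ (12 ∷ 2 ∷ 92 ∷ []) ∷ (2 ∷ 2 ∷ 1 ∷ 3 ∷ 518 ∷ []) ∷ (8 ∷ 2 ∷ 152 ∷ []) ∷
    (4 ∷ 1 ∷ 273 ∷ []) ∷ (4 ∷ 1 ∷ 288 ∷ []) ∷ (12 ∷ 3 ∷ 123 ∷ []) ∷ (18 ∷ 2 ∷ 86 ∷ []) ∷ (11 ∷ 3 ∷ 148 ∷ []) ∷
    (4 ∷ 1 ∷ 352 ∷ []) ∷ (4 ∷ 1 ∷ 369 ∷ []) ∷ (12 ∷ 1 ∷ 148 ∷ []) ∷ (4 ∷ 3 ∷ 467 ∷ []) ∷ (4 ∷ 3 ∷ 488 ∷ []) ∷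
    (4 ∷ 1 ∷ 441 ∷ []) ∷ (4 ∷ 1 ∷ 460 ∷ []) ∷ (9 ∷ 8 ∷ 263 ∷ []) ∷ (40 ∷ 1 ∷ 60 ∷ []) ∷ (3 ∷ 19 ∷ 852 ∷ []) ∷
    (4 ∷ 1 ∷ 540 ∷ []) ∷ (4 ∷ 1 ∷ 561 ∷ []) ∷ (3 ∷ 4 ∷ 897 ∷ []) ∷ (11 ∷ 4 ∷ 1 ∷ 1 ∷ 269 ∷ []) ∷ (6 ∷ 2 ∷ 482 ∷ []) ∷
    (4 ∷ 1 ∷ 649 ∷ []) ∷ (4 ∷ 1 ∷ 672 ∷ []) ∷ (4 ∷ 3 ∷ 803 ∷ []) ∷ (12 ∷ 1 ∷ 276 ∷ []) ∷
    []

  -- The table starts at q = 2. The default `[]` gives weight 0, which `Generates` rejects.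
  exponents : ℕ → List ℕ
  exponents q = fromMaybe [] (head (drop (q ℕ.∸ 2) table))

  -- The first equation gives the matrix the shape (f q²e ; e h); `s ≡ + ∣ s ∣` says in decidable
  -- form that the weight is not negative.
  Generates : ℕ → Element → Set
  Generates q w = b ≡ + q * + q * c × s ≡ + ∣ s ∣ × 0 < ∣ s ∣ × gcd ∣ s ∣ (q ℕ.* q ℕ.∸ 1) ≡ modulus q
    where open Element w

  generates? : ∀ q w → Dec (Generates q w)
  generates? q w = (b ℤ.≟ + q * + q * c) ×-dec ((s ℤ.≟ + ∣ s ∣) ×-dec ((0 ℕ.<? ∣ s ∣) ×-dec (gcd ∣ s ∣ (q ℕ.* q ℕ.∸ 1) ℕ.≟ modulus q)))
    where open Element w

  exponents-generate : ∀ {q} → q < 61 → 2 ≤ q → Generates q (fromR (exponents q))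
  exponents-generate = from-yes (ℕ.allUpTo? (λ q → (2 ℕ.≤? q) →-dec generates? q (fromR (exponents q))) 61)

  -- Sufficiency: reaching every admissible numerator.

  coprime-shift : ∀ i j q t → i ≡ j + t * + q → Coprime ∣ j ∣ q → Coprime ∣ i ∣ q
  coprime-shift i j q t i≡ cop {d} (d∣i , d∣q) = cop (ℤ∣.∣⇒∣ᵤ {+ d} {j}
    (ℤ∣.∣m+n∣n⇒∣m {+ d} {j} (subst (+ d ℤ∣.∣_) i≡ (ℤ∣.∣ᵤ⇒∣ d∣i)) (ℤ∣.∣n⇒∣m*n t (ℤ∣.∣ᵤ⇒∣ d∣q))) , d∣q)

  -- The conditions as necessity delivers them: k ≡ q - 1 (mod 4) replaces the distinction of q
  -- modulo 4.
  record Admissible (q : ℕ) (k : ℤ) : Set where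
    field
      mod-3 : ¬ (3 ∣ q) → + 3 ℤ∣.∣ k
      mod-4 : ¬ (2 ∣ q) → + 4 ℤ∣.∣ k - (+ q - 1ℤ)
      mod-8 : ¬ (2 ∣ q) → IsSquare q → + 8 ℤ∣.∣ k

  open Admissible

  value⇒admissible : ∀ q k .{{_ : NonZero q}} → Coprime ∣ k ∣ q → Value q k → Admissible q k
  value⇒admissible q k cop v = record
    { mod-3 = value⇒3∣k q k cop v
    ; mod-4 = λ 2∤q → value⇒4∣k-[q-1] q k cop v (2∤⇒Odd q 2∤q)
    ; mod-8 = λ { 2∤q (m , refl) → value⇒8∣k m k cop v (2∤⇒Odd q 2∤q) } }

  coprime-*-∣ : ∀ x y n → Coprime x y → x ∣ n → y ∣ n → x ℕ.* y ∣ n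
  coprime-*-∣ x y n cop x∣n (divides t refl) =
    ℕ∣.*-monoˡ-∣ y (coprime-divisor cop (subst (x ∣_) (ℕ.*-comm t y) x∣n))

  modulus-coprime : ∀ q → Coprime (modulus₃ q) (modulus₂ q)
  modulus-coprime q with 3 ∣? q | 2 ∣? q | isSquare? q
  ... | yes _ | _     | _     = λ (d∣1 , _) → ℕ∣.∣1⇒≡1 d∣1
  ... | no  _ | yes _ | _     = λ (_ , d∣1) → ℕ∣.∣1⇒≡1 d∣1
  ... | no  _ | no  _ | yes _ = from-yes (coprime? 3 8)
  ... | no  _ | no  _ | no  _ = from-yes (coprime? 3 4)

  -- Subtracting the congruences for k and k′ leaves divisibilities of qN; q is a unit for each
  -- modulus that occurs and cancels, and the coprime parts combine.
  modulus-∣ : ∀ q k k′ N → Admissible q k → Admissible q k′ → k - k′ ≡ + q * N → + modulus q ℤ∣.∣ N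
  modulus-∣ q k k′ N adm adm′ e = ℤ∣.∣ᵤ⇒∣ (coprime-*-∣ (modulus₃ q) (modulus₂ q) ∣ N ∣ (modulus-coprime q) (ℤ∣.∣⇒∣ᵤ part₃) (ℤ∣.∣⇒∣ᵤ part₂))
    where
    difference : ∀ {m x} → m ℤ∣.∣ k - x → m ℤ∣.∣ k′ - x → m ℤ∣.∣ + q * N
    difference {m} {x} m∣k m∣k′ = subst (m ℤ∣.∣_) (trans (lem k k′ x) e) (ℤ∣.∣m∣n⇒∣m-n m∣k m∣k′)
      where
      lem : ∀ k k′ x → k - x - (k′ - x) ≡ k - k′
      lem = solve-∀
    part₃ : + modulus₃ q ℤ∣.∣ N
    part₃ with 3 ∣? q
    ... | yes _  = ℤ∣.divides N (sym (ℤ.*-identityʳ N))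
    ... | no 3∤q = prime-∣-cancel 3-prime q N 3∤q (subst (+ 3 ℤ∣.∣_) e (ℤ∣.∣m∣n⇒∣m-n (mod-3 adm 3∤q) (mod-3 adm′ 3∤q)))
    part₂ : + modulus₂ q ℤ∣.∣ N
    part₂ with 2 ∣? q | isSquare? q
    ... | yes _  | _      = ℤ∣.divides N (sym (ℤ.*-identityʳ N))
    ... | no 2∤q | yes sq = odd-cancel-8 q N (2∤⇒Odd q 2∤q) (subst (+ 8 ℤ∣.∣_) e (ℤ∣.∣m∣n⇒∣m-n (mod-8 adm 2∤q sq) (mod-8 adm′ 2∤q sq)))
    ... | no 2∤q | no _   = odd-cancel-4 q N (2∤⇒Odd q 2∤q) (difference {+ 4} {+ q - 1ℤ} (mod-4 adm 2∤q) (mod-4 adm′ 2∤q))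

  nonNegative-shift : ∀ i P .{{_ : NonZero P}} Z → ∣ i ∣ ≤ Z → ∃[ n ] + n ≡ i + + P * + Z
  nonNegative-shift (+ a)    P Z _    = a ℕ.+ P ℕ.* Z , cong (λ z → + a + z) (ℤ.pos-* P Z)
  nonNegative-shift -[1+ a ] P Z a<Z = P ℕ.* Z ℕ.∸ suc a ,
    trans (sym (ℤ.⊖-≥ (ℕ.≤-trans a<Z (ℕ.m≤n*m Z P)))) (cong (λ z → -[1+ a ] + z) (ℤ.pos-* P Z))

  bézout-ℤ : ∀ p Q → ∃[ u ] ∃[ v ] u * + p ≡ + gcd p Q + v * + Q
  bézout-ℤ p Q with Bézout.identity (gcd-GCD p Q)
  ... | Bézout.+- x y e = + x , + y , trans (sym (ℤ.pos-* x p)) (trans (cong +_ (sym e)) (cong (λ z → + gcd p Q + z) (ℤ.pos-* y Q)))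
  ... | Bézout.-+ x y e = - + x , - + y , linear-combination (identity (+ x) (+ p) (+ gcd p Q) (+ y) (+ Q))
          (- 1ℤ · trans (cong (λ z → + gcd p Q + z) (sym (ℤ.pos-* x p))) (trans (cong +_ e) (ℤ.pos-* y Q)))
    where
    identity : ∀ x p g y Q → - x * p - (g + - y * Q) ≡ - 1ℤ * (g + x * p - y * Q)
    identity = solve-∀

  -- Bézout gives an integral solution (-vt, -ut). Adding (pZ, QZ) leaves nQ - jp unchanged and, for
  -- large Z, makes both coordinates natural.
  solve-shift : ∀ p Q .{{_ : NonZero p}} .{{_ : NonZero Q}} N → + gcd p Q ℤ∣.∣ N → ∃[ n ] ∃[ j ] N ≡ + n * + Q - + j * + p
  solve-shift p Q N (ℤ∣.divides t N≡) = n , j , linear-combination (identity N t (+ gcd p Q) u v (+ p) (+ Q) (+ Z) (+ n) (+ j))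
      (1ℤ · N≡ ⊕ - t · uv ⊕ - + Q · n≡ ⊕ + p · j≡)
    where
    u = proj₁ (bézout-ℤ p Q)
    v = proj₁ (proj₂ (bézout-ℤ p Q))
    uv = proj₂ (proj₂ (bézout-ℤ p Q))
    Z = ∣ - v * t ∣ ℕ.+ ∣ - u * t ∣
    shift-n = nonNegative-shift (- v * t) p Z (ℕ.m≤m+n _ _)
    shift-j = nonNegative-shift (- u * t) Q Z (ℕ.m≤n+m _ _)
    n = proj₁ shift-n
    n≡ = proj₂ shift-n
    j = proj₁ shift-j
    j≡ = proj₂ shift-j
    identity : ∀ N t g u v p Q Z n j → N - (n * Q - j * p) ≡
      1ℤ * (N - t * g) + - t * (u * p - (g + v * Q)) + - Q * (n - (- v * t + p * Z)) + p * (j - (- u * t + Q * Z))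
    identity = solve-∀

  negative-inverse : ∀ κ q .{{_ : NonZero q}} → Coprime κ q → ∃[ y ] ∃[ z ] κ ℕ.* y ℕ.+ 1 ≡ q ℕ.* z
  negative-inverse κ (suc q) cop with coprime-Bézout cop
  ... | Bézout.-+ x y e = x , y , trans (ℕ.+-comm (κ ℕ.* x) 1) (trans (cong suc (ℕ.*-comm κ x)) (trans e (ℕ.*-comm y (suc q))))
  ... | Bézout.+- x y e = x ℕ.* q , 1 ℕ.+ y ℕ.* q , trans (lem₁ κ x q) (trans (cong (λ t → t ℕ.* q ℕ.+ 1) (sym e)) (lem₂ y q))
    where
    lem₁ : ∀ κ x q → κ ℕ.* (x ℕ.* q) ℕ.+ 1 ≡ x ℕ.* κ ℕ.* q ℕ.+ 1
    lem₁ = ℕ-Solver.solve-∀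
    lem₂ : ∀ y q → (1 ℕ.+ y ℕ.* suc q) ℕ.* q ℕ.+ 1 ≡ suc q ℕ.* (1 ℕ.+ y ℕ.* q)
    lem₂ = ℕ-Solver.solve-∀

  -- Necessity itself locates the family: its member `k₀` is a value, hence admissible, so
  -- `modulus q` divides (k - k₀)/q. By `Generates` this modulus is the gcd of the weight and q² -
  -- 1, so suitable n and j lead from `k₀` to k.
  admissible⇒value : ∀ q .{{_ : NonZero q}} → 2 ≤ q → ∀ w → Generates q w → ∀ k → Coprime ∣ k ∣ q → Admissible q k → Value q k
  admissible⇒value q 2≤q (element {a} {_} {c} {d} {s} factors) (refl , s≡ , 0<s , gcd≡) k cop adm =
    subst (Value q) (sym k≡) (member n j)
    where
    κ = k %ℕ q
    k₁ = k /ℕ q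
    k-split : k ≡ + κ + k₁ * + q
    k-split = ℤ.a≡a%ℕn+[a/ℕn]*n k q
    κ-split : + κ ≡ k + - k₁ * + q
    κ-split = linear-combination (lem (+ κ) k k₁ (+ q)) (- 1ℤ · k-split)
      where
      lem : ∀ κ k k₁ q → κ - (k + - k₁ * q) ≡ - 1ℤ * (k - (κ + k₁ * q))
      lem = solve-∀
    inverse = negative-inverse κ q (coprime-shift (+ κ) k q (- k₁) κ-split cop)
    y = proj₁ inverse
    z = proj₁ (proj₂ inverse)
    κy+1≡qz : κ ℕ.* y ℕ.+ 1 ≡ q ℕ.* z
    κy+1≡qz = proj₂ (proj₂ inverse)
    -- y = 0 would make q divide 1; so the truncated difference E = qy - 2 below is a true one.
    2≤qy : 2 ≤ q ℕ.* y
    2≤qy = at y κy+1≡qz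
      where
      at : ∀ y → κ ℕ.* y ℕ.+ 1 ≡ q ℕ.* z → 2 ≤ q ℕ.* y
      at zero e = contradiction (ℕ.m*n≡1⇒m≡1 q z (trans (sym e) (cong (ℕ._+ 1) (ℕ.*-zeroʳ κ)))) (ℕ.>⇒≢ 2≤q)
      at (suc y) _ = ℕ.≤-trans 2≤q (ℕ.m≤m*n q (suc y))
    2≤q² : 2 ≤ q ℕ.* q
    2≤q² = ℕ.≤-trans 2≤q (ℕ.m≤m*n q q)
    Q₁ = q ℕ.* q ℕ.∸ 1
    instance
      Q₁≢0 : NonZero Q₁
      Q₁≢0 = ℕ.>-nonZero (ℕ.m<n⇒0<n∸m 2≤q²)
      s≢0 : NonZero ∣ s ∣
      s≢0 = ℕ.>-nonZero 0<s
    family = value-family q y (q ℕ.* y ℕ.∸ 2) κ z Q₁ (sym (ℕ.m∸n+n≡m 2≤qy)) κy+1≡qz (sym (ℕ.m∸n+n≡m (ℕ.<⇒≤ 2≤q²))) factors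
    C = proj₁ family
    member : ∀ n j → Value q (+ κ + + q * (C + + n * + Q₁ - + j * s))
    member = proj₂ family
    -- The member with n = j = 0, in the residue class of k modulo q.
    k₀ = + κ + + q * (C + 0ℤ * + Q₁ - 0ℤ * s)
    k₀-split : k₀ ≡ k + (C - k₁) * + q
    k₀-split = linear-combination (lem (+ κ) k k₁ (+ q) C (+ Q₁) s) (- 1ℤ · k-split)
      where
      lem : ∀ κ k k₁ q C Q s → κ + q * (C + 0ℤ * Q - 0ℤ * s) - (k + (C - k₁) * q) ≡ - 1ℤ * (k - (κ + k₁ * q))
      lem = solve-∀
    difference : k - k₀ ≡ + q * (k₁ - C)
    difference = linear-combination (lem k k₀ k₁ (+ q) C) (- 1ℤ · k₀-split)
      where
      lem : ∀ k k₀ k₁ q C → k - k₀ - q * (k₁ - C) ≡ - 1ℤ * (k₀ - (k + (C - k₁) * q))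
      lem = solve-∀
    steps = solve-shift ∣ s ∣ Q₁ (k₁ - C) (subst (λ m → + m ℤ∣.∣ k₁ - C) (sym gcd≡)
      (modulus-∣ q k k₀ (k₁ - C) adm (value⇒admissible q k₀ (coprime-shift k₀ k q (C - k₁) k₀-split cop) (member 0 0)) difference))
    n = proj₁ steps
    j = proj₁ (proj₂ steps)
    k≡ : k ≡ + κ + + q * (C + + n * + Q₁ - + j * s)
    k≡ = combine k₁ (+ κ) C (+ n * + Q₁) (+ j) s (+ ∣ s ∣) k-split s≡ (proj₂ (proj₂ steps))
      where
      combine : ∀ k₁ κ C x j s s′ → k ≡ κ + k₁ * + q → s ≡ s′ → k₁ - C ≡ x - j * s′ → k ≡ κ + + q * (C + x - j * s)
      combine k₁ κ C x j s _ e refl f = linear-combination (identity k k₁ κ C x j s (+ q)) (1ℤ · e ⊕ + q · f)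
        where
        identity : ∀ k k₁ κ C x j s q → k - (κ + q * (C + x - j * s)) ≡ 1ℤ * (k - (κ + k₁ * q)) + q * (k₁ - C - (x - j * s))
        identity = solve-∀

  -- Translation of the conditions into remainders.

  %ℕ≡0⇒∣ : ∀ k m .{{_ : NonZero m}} → k %ℕ m ≡ 0 → + m ℤ∣.∣ k
  %ℕ≡0⇒∣ k m e = ℤ∣.divides (k /ℕ m) (trans (ℤ.a≡a%ℕn+[a/ℕn]*n k m) (trans (cong (λ r → + r + k /ℕ m * + m) e) (ℤ.+-identityˡ _)))

  ∣⇒%ℕ≡0 : ∀ k m .{{_ : NonZero m}} → + m ℤ∣.∣ k → k %ℕ m ≡ 0
  ∣⇒%ℕ≡0 k m (ℤ∣.divides t e) = %ℕ-unique k m 0 t (trans e (sym (ℤ.+-identityˡ _))) (ℕ.>-nonZero⁻¹ m)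

  odd%4 : ∀ q → ¬ (2 ∣ q) → (q % 4 ≡ 1) ⊎ (q % 4 ≡ 3)
  odd%4 q 2∤q with q % 4 in eq | m%n<n q 4
  ... | 0 | _ = contradiction (ℕ∣.∣-trans (divides 2 refl) (ℕ∣.m%n≡0⇒n∣m q 4 eq)) 2∤q
  ... | 1 | _ = inj₁ refl
  ... | 2 | _ = contradiction (divides (1 ℕ.+ q ℕ./ 4 ℕ.* 2) (trans (m≡m%n+[m/n]*n q 4) (trans (cong (ℕ._+ q ℕ./ 4 ℕ.* 4) eq) (lem (q ℕ./ 4))))) 2∤q
    where
    lem : ∀ x → 2 ℕ.+ x ℕ.* 4 ≡ (1 ℕ.+ x ℕ.* 2) ℕ.* 2
    lem = ℕ-Solver.solve-∀
  ... | 3 | _ = inj₂ refl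
  ... | suc (suc (suc (suc _))) | s≤s (s≤s (s≤s (s≤s ())))

  +-%4 : ∀ q r → q % 4 ≡ r → + q ≡ + r + + (q ℕ./ 4) * + 4
  +-%4 q r e = trans (cong +_ (trans (m≡m%n+[m/n]*n q 4) (cong (ℕ._+ q ℕ./ 4 ℕ.* 4) e))) (cong (λ z → + r + z) (ℤ.pos-* (q ℕ./ 4) 4))

  -- The passage from `suc r` to `r` is the -1 in k ≡ q - 1; it treats q ≡ 1 and q ≡ 3 at once.
  mod-4⇒%ℕ : ∀ q k r → q % 4 ≡ suc r → r < 4 → + 4 ℤ∣.∣ k - (+ q - 1ℤ) → k %ℕ 4 ≡ r
  mod-4⇒%ℕ q k r e r<4 (ℤ∣.divides t k≡) = %ℕ-unique k 4 r (t + + (q ℕ./ 4))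
    (linear-combination (identity k (+ q) (+ r) t (+ (q ℕ./ 4))) (1ℤ · k≡ ⊕ 1ℤ · +-%4 q (suc r) e)) r<4
    where
    identity : ∀ k q r t i → k - (r + (t + i) * + 4) ≡ 1ℤ * (k - (q - 1ℤ) - t * + 4) + 1ℤ * (q - (1ℤ + r + i * + 4))
    identity = solve-∀

  %ℕ⇒mod-4 : ∀ q k r → q % 4 ≡ suc r → k %ℕ 4 ≡ r → + 4 ℤ∣.∣ k - (+ q - 1ℤ)
  %ℕ⇒mod-4 q k r e f = ℤ∣.divides (k /ℕ 4 - + (q ℕ./ 4))
    (linear-combination (identity k (+ q) (+ r) (k /ℕ 4) (+ (q ℕ./ 4)))
      (1ℤ · trans (ℤ.a≡a%ℕn+[a/ℕn]*n k 4) (cong (λ x → + x + k /ℕ 4 * + 4) f) ⊕ - 1ℤ · +-%4 q (suc r) e))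
    where
    identity : ∀ k q r t i → k - (q - 1ℤ) - (t - i) * + 4 ≡ 1ℤ * (k - (r + t * + 4)) + - 1ℤ * (q - (1ℤ + r + i * + 4))
    identity = solve-∀

  Conditions : ℕ → ℤ → Set
  Conditions q k = (¬ (3 ∣ q) → k %ℕ 3 ≡ 0)
    × (¬ (2 ∣ q) →
         (q % 4 ≡ 3 → k %ℕ 4 ≡ 2)
       × (∃[ m ] m ℕ.* m ≡ q → k %ℕ 8 ≡ 0)
       × (¬ (q % 4 ≡ 3) → ¬ (∃[ m ] m ℕ.* m ≡ q) → k %ℕ 4 ≡ 0))

  admissible⇒conditions : ∀ q k → Admissible q k → Conditions q k
  admissible⇒conditions q k adm = (λ 3∤q → ∣⇒%ℕ≡0 k 3 (mod-3 adm 3∤q)) , λ 2∤q →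
    (λ e → mod-4⇒%ℕ q k 2 e (s≤s (s≤s (s≤s z≤n))) (mod-4 adm 2∤q)) ,
    (λ sq → ∣⇒%ℕ≡0 k 8 (mod-8 adm 2∤q sq)) ,
    (λ q%4≢3 _ → one 2∤q q%4≢3 (odd%4 q 2∤q))
    where
    one : ¬ (2 ∣ q) → ¬ (q % 4 ≡ 3) → (q % 4 ≡ 1) ⊎ (q % 4 ≡ 3) → k %ℕ 4 ≡ 0
    one 2∤q _ (inj₁ e) = mod-4⇒%ℕ q k 0 e (s≤s z≤n) (mod-4 adm 2∤q)
    one _ q%4≢3 (inj₂ e) = contradiction e q%4≢3

  -- For q ≡ 1 (mod 4), k ≡ 0 (mod 4) is granted outright only to non-squares; for squares it
  -- follows from k ≡ 0 (mod 8). Hence the decision whether q is a square.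
  conditions⇒admissible : ∀ q k → Conditions q k → Admissible q k
  conditions⇒admissible q k (cond₃ , cond₂) = record
    { mod-3 = λ 3∤q → %ℕ≡0⇒∣ k 3 (cond₃ 3∤q)
    ; mod-4 = λ 2∤q → four 2∤q (odd%4 q 2∤q) (isSquare? q)
    ; mod-8 = λ 2∤q sq → %ℕ≡0⇒∣ k 8 (proj₁ (proj₂ (cond₂ 2∤q)) sq) }
    where
    four : ¬ (2 ∣ q) → (q % 4 ≡ 1) ⊎ (q % 4 ≡ 3) → Dec (IsSquare q) → + 4 ℤ∣.∣ k - (+ q - 1ℤ)
    four 2∤q (inj₂ e) _ = %ℕ⇒mod-4 q k 2 e (proj₁ (cond₂ 2∤q) e)
    four 2∤q (inj₁ e) (no ¬sq) = %ℕ⇒mod-4 q k 0 e (proj₂ (proj₂ (cond₂ 2∤q)) (λ e₃ → contradiction (trans (sym e) e₃) λ ()) ¬sq)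
    four 2∤q (inj₁ e) (yes sq) = %ℕ⇒mod-4 q k 0 e (∣⇒%ℕ≡0 k 4 (ℤ∣.∣-trans (ℤ∣.divides (+ 2) refl) (%ℕ≡0⇒∣ k 8 (proj₁ (proj₂ (cond₂ 2∤q)) sq))))

  -- Return to rational Dedekind sums.

  DedekindValue : (q : ℕ) .{{_ : NonZero q}} → ℤ → Set
  DedekindValue q k = Σ ℤ λ a → Σ ℕ λ b → Σ (NonZero b) λ nz → Coprime ∣ a ∣ b × normDedekind a b {{nz}} ≡ k ℚ./ q

  -- D takes natural arguments, so a is replaced by its residue modulo b, which is still prime to b.
  dedekind⇒value : ∀ q .{{_ : NonZero q}} k → DedekindValue q k → Value q k
  dedekind⇒value q k (a , b , nz , cop , e) = a %ℕ b , b , nz , cop₀ ,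
    /-cross⁻¹ (D (a %ℕ b) b) k b q (trans (sym (normDedekind-D a b (a %ℕ b) (a /ℕ b) (ℤ.a≡a%ℕn+[a/ℕn]*n a b) cop₀)) e)
    where
    instance
      b≢0 : NonZero b
      b≢0 = nz
    lem : ∀ r a t b → r - (a + - t * b) ≡ - 1ℤ * (a - (r + t * b))
    lem = solve-∀
    cop₀ : Coprime (a %ℕ b) b
    cop₀ = coprime-shift (+ (a %ℕ b)) a b (- (a /ℕ b))
      (linear-combination (lem (+ (a %ℕ b)) a (a /ℕ b) (+ b)) (- 1ℤ · ℤ.a≡a%ℕn+[a/ℕn]*n a b)) cop

  value⇒dedekind : ∀ q .{{_ : NonZero q}} k → Value q k → DedekindValue q k
  value⇒dedekind q k (a , b , nz , cop , e) = + a , b , nz , cop ,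
    trans (normDedekind-D (+ a) b {{nz}} a 0ℤ (sym (ℤ.+-identityʳ (+ a))) cop) (/-cross (D a b {{nz}}) k b q {{nz}} e)

open import Data.Nat using (ℕ; NonZero; _≤_; _%_; _*_)
open import Data.Nat.Divisibility using (_∣_)
open import Data.Nat.Coprimality using (Coprime)
open import Data.Integer using (ℤ; ∣_∣; _%ℕ_)
open import Data.Rational using (ℚ; _/_)
open import Data.Product using (Σ; ∃; ∃-syntax; _×_)
open import Relation.Nullary using (¬_)
open import Relation.Binary.PropositionalEquality using (_≡_)
open import Function.Bundles using (_⇔_)
open import Data.Nat using (s≤s)
open import Function.Bundles using (mk⇔)

open DedekindValues

theorem2 : (q : ℕ) .{{_ : NonZero q}} → 2 ≤ q → q ≤ 60 → (k : ℤ) → Coprime ∣ k ∣ q →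
    ((Σ ℤ λ a → Σ ℕ λ b → Σ (NonZero b) λ nz → Coprime ∣ a ∣ b × normDedekind a b {{nz}} ≡ k / q)
    ⇔ ((¬ (3 ∣ q) → k %ℕ 3 ≡ 0)
    × (¬ (2 ∣ q) →
    (q % 4 ≡ 3 → k %ℕ 4 ≡ 2)
    × (∃[ m ] m * m ≡ q → k %ℕ 8 ≡ 0)
    × (¬ (q % 4 ≡ 3) → ¬ (∃[ m ] m * m ≡ q) → k %ℕ 4 ≡ 0))))
theorem2 q 2≤q q≤60 k cop = mk⇔
  (λ v → admissible⇒conditions q k (value⇒admissible q k cop (dedekind⇒value q k v)))
  (λ c → value⇒dedekind q k (admissible⇒value q 2≤q (fromR (exponents q)) (exponents-generate (s≤s q≤60) 2≤q) k cop
    (conditions⇒admissible q k c)))
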